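{- Let $\Gamma$ be a finite abelian group with $\Gamma(3)=\emptyset$, and let $S\subseteq\Gamma$ be skew-symmetric with $0\notin S$. Then the oriented Cayley graph $\mathrm{Cay}(\Gamma,S)$ is HS-integral if and only if $S=\emptyset$.
   Context: $\Gamma$ is written additively. $\Gamma(3)$ is the set of elements of $\Gamma$ whose order is divisible by $3$. A set $S$ is skew-symmetric if $-a\notin S$ for all $a\in S$. $\mathrm{Cay}(\Gamma,S)$ has vertex set $\Gamma$ and arcs $(a,b)$ with $b-a\in S$. Its Hermitian adjacency matrix of second kind $\mathcal{H}=(h_{uv})$ has $h_{uv}=1$ if both $(u,v)$ and $(v,u)$ are arcs, $h_{uv}=\frac{1+i\sqrt3}{2}$ if only $(u,v)$ is an arc, $h_{uv}=\frac{1-i\sqrt3}{2}$ if only $(v,u)$ is an arc, and $h_{uv}=0$ otherwise. The graph is HS-integral if all eigenvalues of $\mathcal{H}$ are integers. -}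

module Defs where

open import Data.Bool using (Bool; true; false)
open import Data.Nat as ℕ using (ℕ; zero; suc; _≤_; _<_)
open import Data.Nat.Divisibility using (_∣_)
open import Data.Integer as ℤ using (ℤ; +_)
open import Data.Fin as Fin using (Fin; zero; suc; punchIn)
open import Data.Fin.Subset using (Subset; _∈_; _∉_)
open import Data.List using (List; []; _∷_; map)
open import Data.Vec as Vec using (Vec; lookup)
open import Data.Product using (Σ; _×_)
open import Algebra.Structures using (IsAbelianGroup)
open import Relation.Binary.PropositionalEquality using (_≡_)
open import Relation.Nullary using (¬_; yes; no)

-- Finite abelian groups, written additively, with elements labelled
-- by Fin n (every finite group is isomorphic to one on Fin n).

record FinAbGroup : Set where
  field
    n        : ℕ
    _⊕_      : Fin n → Fin n → Fin n
    𝟘        : Fin n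
    ⊖_       : Fin n → Fin n
    isAbelianGroup : IsAbelianGroup _≡_ _⊕_ 𝟘 ⊖_

  _⊝_ : Fin n → Fin n → Fin n
  a ⊝ b = a ⊕ (⊖ b)

  _·_ : ℕ → Fin n → Fin n
  zero  · a = 𝟘
  suc k · a = a ⊕ (k · a)

  HasOrder : Fin n → ℕ → Set
  HasOrder a k = (1 ≤ k) × (k · a ≡ 𝟘) × (∀ j → 1 ≤ j → j < k → ¬ (j · a ≡ 𝟘))

  Γ3Empty : Set
  Γ3Empty = ∀ a k → HasOrder a k → ¬ (3 ∣ k)

  SkewSymmetric : Subset n → Set
  SkewSymmetric S = ∀ a → a ∈ S → (⊖ a) ∉ S

-- Eisenstein integers ℤ[ω], ⟨ a , b ⟩ = a + bω, ω = (-1 + i√3)/2, ω² = -1 - ω.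
-- They embed injectively into ℂ; (1+i√3)/2 = 1 + ω, (1-i√3)/2 = -ω.

record ℤω : Set where
  constructor ⟨_,_⟩
  field
    re : ℤ
    im : ℤ

-- minimal ring operations (no laws needed to define det)
record RingOps (A : Set) : Set where
  field
    0# 1#    : A
    _+ᵣ_ _*ᵣ_ : A → A → A
    -ᵣ_      : A → A

ℤωOps : RingOps ℤω
ℤωOps = record
  { 0#  = ⟨ + 0 , + 0 ⟩
  ; 1#  = ⟨ + 1 , + 0 ⟩
  ; _+ᵣ_ = λ x y → ⟨ ℤω.re x ℤ.+ ℤω.re y , ℤω.im x ℤ.+ ℤω.im y ⟩
  ; _*ᵣ_ = λ x y → let a = ℤω.re x ; b = ℤω.im x ; c = ℤω.re y ; d = ℤω.im y in
                   ⟨ a ℤ.* c ℤ.- b ℤ.* d , a ℤ.* d ℤ.+ b ℤ.* c ℤ.- b ℤ.* d ⟩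
  ; -ᵣ_  = λ x → ⟨ ℤ.- ℤω.re x , ℤ.- ℤω.im x ⟩
  }

ιℤ : ℤ → ℤω
ιℤ k = ⟨ k , + 0 ⟩

-- Polynomials as coefficient lists (constant term first).

module PolyDefs {A : Set} (R : RingOps A) where
  open RingOps R

  padd : List A → List A → List A
  padd []       q        = q
  padd (a ∷ p)  []       = a ∷ p
  padd (a ∷ p)  (b ∷ q)  = (a +ᵣ b) ∷ padd p q

  pmul : List A → List A → List A
  pmul []      q = []
  pmul (a ∷ p) q = padd (map (a *ᵣ_) q) (0# ∷ pmul p q)

  PolyOps : RingOps (List A)
  PolyOps = record
    { 0# = [] ; 1# = 1# ∷ [] ; _+ᵣ_ = padd ; _*ᵣ_ = pmul ; -ᵣ_ = map -ᵣ_ }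

  coeff : List A → ℕ → A
  coeff []      k       = 0#
  coeff (a ∷ p) zero    = a
  coeff (a ∷ p) (suc k) = coeff p k

  _≈ₚ_ : List A → List A → Set
  p ≈ₚ q = ∀ k → coeff p k ≡ coeff q k

module DetDefs {A : Set} (R : RingOps A) where
  open RingOps R

  sumFin : ∀ {m} → (Fin m → A) → A
  sumFin {zero}  f = 0#
  sumFin {suc m} f = f zero +ᵣ sumFin (λ i → f (suc i))

  alt : ℕ → A → A
  alt zero    x = x
  alt (suc k) x = -ᵣ alt k x

  det : ∀ m → (Fin m → Fin m → A) → A
  det zero    M = 1#
  det (suc m) M = sumFin (λ j → alt (Fin.toℕ j)
                    (M zero j *ᵣ det m (λ r c → M (suc r) (punchIn j c))))

open PolyDefs ℤωOps public
open RingOps ℤωOps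

charPoly : ∀ m → (Fin m → Fin m → ℤω) → List ℤω
charPoly m H = DetDefs.det PolyOps m entry
  where
  entry : Fin m → Fin m → List ℤω
  entry r c with r Fin.≟ c
  ... | yes _ = (-ᵣ H r c) ∷ 1# ∷ []
  ... | no  _ = (-ᵣ H r c) ∷ []

prodLinear : ∀ {m} → Vec ℤ m → List ℤω
prodLinear Vec.[]       = 1# ∷ []
prodLinear (l Vec.∷ ls) = pmul ((-ᵣ ιℤ l) ∷ 1# ∷ []) (prodLinear ls)

-- Hermitian adjacency matrix of the second kind of Cay(Γ,S):
-- arc (u,v) iff v - u ∈ S.

module _ (Γ : FinAbGroup) where
  open FinAbGroup Γ

  hermAdj2 : Subset n → Fin n → Fin n → ℤω
  hermAdj2 S u v with lookup S (v ⊝ u) | lookup S (u ⊝ v)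
  ... | true  | true  = ⟨ + 1 , + 0 ⟩
  ... | true  | false = ⟨ + 1 , + 1 ⟩          -- (1+i√3)/2 = 1 + ω
  ... | false | true  = ⟨ + 0 , ℤ.- + 1 ⟩      -- (1-i√3)/2 = -ω
  ... | false | false = ⟨ + 0 , + 0 ⟩

  -- HS-integral: all eigenvalues of H (roots of its characteristic
  -- polynomial, with multiplicity) are integers
  HSIntegral : Subset n → Set
  HSIntegral S = Σ (Vec ℤ n) λ ls → charPoly n (hermAdj2 S) ≈ₚ prodLinear ls

{-# OPTIONS --safe #-}
-- Let h = Σ a(g) g in ℤ[ω][Γ], where a(g) is the matrix entry attached to the
-- difference g; the Hermitian matrix is the matrix of multiplication by h, so
-- its characteristic polynomial χ annihilates h (the vector of group elements
-- lies in the kernel of h·I − H).  Suppose χ = ∏ (x − lᵢ) with lᵢ ∈ ℤ, and let p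
-- be a prime, p ≠ 3, such that g ↦ p g is injective.  Modulo p every h − lᵢ
-- divides hᵖ − h = (h − lᵢ)ᵖ − (h − lᵢ), so hᵖ − h is nilpotent.  The Frobenius
-- map x ↦ xᵖ sends Σ x(g) g to Σ x(g)ᵖ (p g), hence it is injective, the ring
-- is reduced modulo p, and hᵖ = h.  Comparing coefficients, a(p g) = a(g)ᵖ
-- modulo p, which is a(g) or its conjugate according to p mod 3; since the
-- values of a are 0 and (1 ± i√3)/2, this holds exactly.  Now take k ≡ 2 mod 3
-- with k g = g for all g, which exists as Γ has no 3-torsion.  Composing over
-- the prime factors of k, a(g) = a(k g) is its own conjugate, so a = 0.
-- Working with all prime factors of k avoids Dirichlet's theorem, and working
-- modulo p avoids characters and Galois theory.
module Submission where

open import Defs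
open import Algebra.Bundles using (AbelianGroup; CommutativeRing)
open import Data.Bool using (Bool; true; false)
open import Data.Empty using (⊥-elim)
open import Data.Fin as Fin using (Fin; zero; suc; punchIn; toℕ)
open import Data.Fin.Induction using (<-weakInduction)
open import Data.Fin.Permutation using (Permutation; permutation)
open import Data.Fin.Properties using (toℕ<n; toℕ-inject₁; toℕ-fromℕ)
open import Data.Fin.Subset using (Subset; _∉_; Empty)
open import Data.Integer as ℤ using (ℤ; +_; -[1+_])
open import Data.Integer.Divisibility.Signed as ℤ∣ using (∣⇒∣ᵤ) renaming (_∣_ to _∣ℤ_)
import Data.Integer.Properties as ℤ
open import Data.Integer.Tactic.RingSolver using (solve-∀)
open import Data.List using (List; []; _∷_; map)
open import Data.List.Relation.Unary.All using (All; []; _∷_)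
open import Data.Nat as ℕ using (ℕ; zero; suc; _<_; _≤_; _∸_; _!; s≤s; z≤n)
open import Data.Nat.Combinatorics using (nCn≡1; nCk≡n!/k![n-k]!; k![n∸k]!∣n!) renaming (_C_ to _choose_)
open import Data.Nat.DivMod using (_%_; _/_; %-distribˡ-*; %-distribˡ-+; m%n<n; m/n*n≡m; m≡m%n+[m/n]*n)
open import Data.Nat.Divisibility using (_∣_; divides; _∣?_; ∣1⇒≡1; m%n≡0⇒n∣m; n∣m⇒m%n≡0; ∣-trans; ∣-refl; m∣m*n; n∣m*n; >⇒∤)
open import Data.Nat.Induction using (<-rec)
open import Data.Nat.ListAction using (product)
open import Data.Nat.Primality using (Prime; euclidsLemma; ¬prime[0]; ¬prime[1])
open import Data.Nat.Primality.Factorisation using (factorise; PrimeFactorisation)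
import Data.Nat.Properties as ℕ
open import Data.Nat.Tactic.RingSolver using () renaming (solve-∀ to solve-∀-ℕ)
open import Data.Product using (Σ; ∃-syntax; _×_; _,_; proj₁; proj₂)
open import Data.Sum using (_⊎_; inj₁; inj₂)
open import Data.Vec as Vec using (Vec; lookup; replicate)
open import Data.Vec.Properties using ([]=⇒lookup; lookup⇒[]=)
open import Function using (_∘_)
open import Function.Bundles using (_⇔_; mk⇔)
open import Level using (0ℓ)
open import Relation.Binary.PropositionalEquality as ≡ using (_≡_; _≢_; cong)
open import Relation.Nullary using (¬_; Dec; yes; no)

open RingOps ℤωOps renaming (0# to 0ω; 1# to 1ω)

-- Determinants by expansion along the first row

-- Transposition of the positions i and i + 1. Only neighbours are exchanged, because deleting a
-- column then yields again either a neighbour exchange or a shift by one.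
swap : ∀ {m} → Fin m → Fin (suc m) → Fin (suc m)
swap zero    zero          = suc zero
swap zero    (suc zero)    = zero
swap zero    (suc (suc k)) = suc (suc k)
swap (suc i) zero          = zero
swap (suc i) (suc k)       = suc (swap i k)

swap-involutive : ∀ {m} (i : Fin m) j → swap i (swap i j) ≡ j
swap-involutive zero    zero          = ≡.refl
swap-involutive zero    (suc zero)    = ≡.refl
swap-involutive zero    (suc (suc k)) = ≡.refl
swap-involutive (suc i) zero          = ≡.refl
swap-involutive (suc i) (suc k)       = cong suc (swap-involutive i k)

swap-inject₁ : ∀ {m} (i : Fin m) → swap i (Fin.inject₁ i) ≡ suc i
swap-inject₁ zero    = ≡.refl
swap-inject₁ (suc i) = cong suc (swap-inject₁ i)

-- How a neighbour exchange meets the deletion of column j. If j takes part in it, deleting j before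
-- equals deleting its image after, and the index changes by one, which flips the sign. Otherwise
-- the exchange descends to the minor as the neighbour exchange `i′`.
data SwapPunchIn {m} (i : Fin (suc m)) (j : Fin (suc (suc m))) : Set where
  moved : toℕ j ≡ suc (toℕ (swap i j)) ⊎ suc (toℕ j) ≡ toℕ (swap i j) →
          (∀ c → swap i (punchIn j c) ≡ punchIn (swap i j) c) → SwapPunchIn i j
  fixed : swap i j ≡ j → (i′ : Fin m) →
          (∀ c → swap i (punchIn j c) ≡ punchIn j (swap i′ c)) → SwapPunchIn i j

swapPunchIn : ∀ {m} (i : Fin (suc m)) j → SwapPunchIn i j
swapPunchIn zero zero = moved (inj₂ ≡.refl) λ { zero → ≡.refl ; (suc c) → ≡.refl }
swapPunchIn zero (suc zero) = moved (inj₁ ≡.refl) λ { zero → ≡.refl ; (suc c) → ≡.refl }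
swapPunchIn {suc m} zero (suc (suc j)) = fixed ≡.refl zero
  λ { zero → ≡.refl ; (suc zero) → ≡.refl ; (suc (suc c)) → ≡.refl }
swapPunchIn {suc m} (suc i) zero = fixed ≡.refl i λ c → ≡.refl
swapPunchIn {suc m} (suc i) (suc j) with swapPunchIn i j
... | moved (inj₁ s) e = moved (inj₁ (cong suc s)) λ { zero → ≡.refl ; (suc c) → cong suc (e c) }
... | moved (inj₂ s) e = moved (inj₂ (cong suc s)) λ { zero → ≡.refl ; (suc c) → cong suc (e c) }
... | fixed s i′ e = fixed (cong suc s) (suc i′) λ { zero → ≡.refl ; (suc c) → cong suc (e c) }

-- The source carries operations without laws, because coefficient lists obey the ring laws only up
-- to trailing zeros.
record IsRingHom {A : Set} (opsA : RingOps A) (R : CommutativeRing 0ℓ 0ℓ)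
                 (f : A → CommutativeRing.Carrier R) : Set where
  open RingOps opsA renaming (0# to 0ₐ; 1# to 1ₐ; _+ᵣ_ to _+ₐ_; _*ᵣ_ to _*ₐ_; -ᵣ_ to -ₐ_)
  open CommutativeRing R
  field
    0-homo : f 0ₐ ≈ 0#
    1-homo : f 1ₐ ≈ 1#
    +-homo : ∀ x y → f (x +ₐ y) ≈ f x + f y
    *-homo : ∀ x y → f (x *ₐ y) ≈ f x * f y
    neg-homo : ∀ x → f (-ₐ x) ≈ - f x

module FiniteSums (R : CommutativeRing 0ℓ 0ℓ) where
  open CommutativeRing R hiding (zero)
  open import Algebra.Properties.Ring ring using (-1*x≈-x)
  open import Algebra.Properties.Semiring.Sum semiring

  sum-zero : ∀ {m} {f : Fin m → Carrier} → (∀ i → f i ≈ 0#) → sum f ≈ 0#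
  sum-zero {m} z = trans (sum-cong-≋ z) (sum-replicate-zero m)

  sum-neg : ∀ {m} (f : Fin m → Carrier) → sum (λ i → - f i) ≈ - sum f
  sum-neg f = trans (sum-cong-≋ (λ i → sym (-1*x≈-x (f i))))
                (trans (sym (*-distribˡ-sum (- 1#) f)) (-1*x≈-x (sum f)))

  sum-single : ∀ {m} (j : Fin m) (f : Fin m → Carrier) → (∀ i → i ≢ j → f i ≈ 0#) → sum f ≈ f j
  sum-single {suc m} zero f z = trans
    (+-congˡ (sum-zero (λ i → z (suc i) (λ ())))) (+-identityʳ _)
  sum-single {suc m} (suc j) f z = trans
    (+-cong (z zero (λ ())) (sum-single j (f ∘ suc) (λ i ne → z (suc i) (λ { ≡.refl → ne ≡.refl }))))
    (+-identityˡ _)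

module Determinant (R : CommutativeRing 0ℓ 0ℓ) where
  open CommutativeRing R hiding (zero)
  open FiniteSums R
  open import Algebra.Properties.Ring ring
  open import Algebra.Properties.Semiring.Sum semiring
  open import Relation.Binary.Reasoning.Setoid setoid
  open import Algebra.Solver.Ring.NaturalCoefficients.Default commutativeSemiring
    using (solve; _:=_; _:+_; _:*_)

  ops : RingOps Carrier
  ops = record { 0# = 0# ; 1# = 1# ; _+ᵣ_ = _+_ ; _*ᵣ_ = _*_ ; -ᵣ_ = -_ }

  open DetDefs ops public

  Matrix : ℕ → Set
  Matrix m = Fin m → Fin m → Carrier

  minor : ∀ {m} → Matrix (suc m) → Fin (suc m) → Matrix m
  minor M j r c = M (suc r) (punchIn j c)

  term : ∀ {m} → Matrix (suc m) → Fin (suc m) → Carrier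
  term {m} M j = alt (toℕ j) (M zero j * det m (minor M j))

  sumFin≡sum : ∀ {m} (f : Fin m → Carrier) → sumFin f ≡ sum f
  sumFin≡sum {zero}  f = ≡.refl
  sumFin≡sum {suc m} f = cong (λ s → f zero + s) (sumFin≡sum (f ∘ suc))

  laplace : ∀ {m} (M : Matrix (suc m)) → det (suc m) M ≈ sum (term M)
  laplace M = reflexive (sumFin≡sum (term M))

  alt-cong : ∀ k {x y} → x ≈ y → alt k x ≈ alt k y
  alt-cong zero    e = e
  alt-cong (suc k) e = -‿cong (alt-cong k e)

  alt-neg : ∀ k x → alt k (- x) ≈ - alt k x
  alt-neg zero    x = refl
  alt-neg (suc k) x = -‿cong (alt-neg k x)

  alt-zero : ∀ k {x} → x ≈ 0# → alt k x ≈ 0#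
  alt-zero zero    e = e
  alt-zero (suc k) e = trans (-‿cong (alt-zero k e)) -0#≈0#

  alt-linear : ∀ k a x y → alt k (a * x + y) ≈ a * alt k x + alt k y
  alt-linear zero    a x y = refl
  alt-linear (suc k) a x y = trans (-‿cong (alt-linear k a x y))
    (trans (sym (-‿+-comm _ _)) (+-congʳ (-‿distribʳ-* _ _)))

  det-cong : ∀ m {M N : Matrix m} → (∀ r c → M r c ≈ N r c) → det m M ≈ det m N
  det-cong zero    e = refl
  det-cong (suc m) {M} {N} e = begin
    det (suc m) M ≈⟨ laplace M ⟩
    sum (term M)  ≈⟨ sum-cong-≋ (λ j → alt-cong (toℕ j)
                      (*-cong (e zero j) (det-cong m (λ r c → e (suc r) (punchIn j c))))) ⟩
    sum (term N)  ≈⟨ laplace N ⟨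
    det (suc m) N ∎

  -- Reindex the expansion by the transposition. A term whose column is moved changes sign through
  -- its index; a term whose column is fixed changes sign through its minor, by induction.
  det-swap : ∀ {m} (i : Fin m) (M : Matrix (suc m)) →
             det (suc m) (λ r c → M r (swap i c)) ≈ - det (suc m) M
  det-swap {suc m} i M = begin
    det (suc (suc m)) M′             ≈⟨ laplace M′ ⟩
    sum (term M′)                    ≈⟨ sum-cong-≋ swapped ⟩
    sum (λ j → - term M (swap i j))  ≈⟨ sum-neg (term M ∘ swap i) ⟩
    - sum (term M ∘ swap i)          ≈⟨ -‿cong (sum-permute (term M) π) ⟨
    - sum (term M)                   ≈⟨ -‿cong (laplace M) ⟨
    - det (suc (suc m)) M            ∎
    where
    M′ : Matrix (suc (suc m))
    M′ r c = M r (swap i c)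
    π = permutation (swap i) (swap i) (swap-involutive i) (swap-involutive i)

    altSuc : ∀ {a b} → a ≡ suc b ⊎ suc a ≡ b → ∀ x → alt a x ≈ - alt b x
    altSuc (inj₁ ≡.refl) x = refl
    altSuc (inj₂ ≡.refl) x = sym (-‿involutive _)

    swapped : ∀ j → term M′ j ≈ - term M (swap i j)
    swapped j with swapPunchIn i j
    ... | moved s e = trans
      (alt-cong (toℕ j) (*-congˡ (det-cong (suc m) (λ r c → reflexive (cong (M (suc r)) (e c))))))
      (altSuc s _)
    ... | fixed s i′ e = begin
      alt (toℕ j) (M zero (swap i j) * det (suc m) (minor M′ j))
        ≈⟨ alt-cong (toℕ j) (*-congˡ (trans
             (det-cong (suc m) (λ r c → reflexive (cong (M (suc r)) (e c))))
             (det-swap i′ (minor M j)))) ⟩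
      alt (toℕ j) (M zero (swap i j) * - det (suc m) (minor M j))
        ≈⟨ alt-cong (toℕ j) (-‿distribʳ-* _ _) ⟨
      alt (toℕ j) (- (M zero (swap i j) * det (suc m) (minor M j)))
        ≈⟨ alt-neg (toℕ j) _ ⟩
      - alt (toℕ j) (M zero (swap i j) * det (suc m) (minor M j))
        ≡⟨ cong (λ k → - alt (toℕ j) (M zero (swap i j) * det (suc m) (minor M k))) s ⟨
      - alt (toℕ j) (M zero (swap i j) * det (suc m) (minor M (swap i j)))
        ≡⟨ cong (λ k → - alt (toℕ k) (M zero (swap i j) * det (suc m) (minor M (swap i j)))) s ⟨
      - term M (swap i j) ∎

  mutual
    -- The first two terms of the expansion cancel, and every later minor still begins with two
    -- equal columns. Antisymmetry would give only that twice the determinant vanishes, which says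
    -- nothing modulo 2, and the prime 2 does occur.
    det-equalColumns₀₁ : ∀ {m} (M : Matrix (suc (suc m))) →
                         (∀ r → M r zero ≈ M r (suc zero)) → det (suc (suc m)) M ≈ 0#
    det-equalColumns₀₁ {m} M e = begin
      det (suc (suc m)) M ≈⟨ laplace M ⟩
      term M zero + (term M (suc zero) + sum (λ j → term M (suc (suc j))))
        ≈⟨ +-congˡ (+-cong (-‿cong (*-cong (sym (e zero)) (det-cong (suc m) sameMinors)))
                           (sum-zero (laterTerms M e))) ⟩
      term M zero + (- term M zero + 0#)
        ≈⟨ +-congˡ (+-identityʳ _) ⟩
      term M zero + - term M zero
        ≈⟨ -‿inverseʳ _ ⟩
      0# ∎
      where
      sameMinors : ∀ r c → minor M (suc zero) r c ≈ minor M zero r c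
      sameMinors r zero    = e (suc r)
      sameMinors r (suc c) = refl

    laterTerms : ∀ {m} (M : Matrix (suc (suc m))) → (∀ r → M r zero ≈ M r (suc zero)) →
                 (j : Fin m) → term M (suc (suc j)) ≈ 0#
    laterTerms {suc m} M e j = alt-zero (suc (suc (toℕ j)))
      (trans (*-congˡ (det-equalColumns₀₁ (minor M (suc (suc j))) (e ∘ suc))) (zeroʳ _))

  EqualColumnsVanish : ∀ {m} → Fin m → Set
  EqualColumnsVanish {m} j = ∀ (M : Matrix (suc m)) →
    (∀ r → M r zero ≈ M r (suc j)) → det (suc m) M ≈ 0#

  -- Neighbour exchanges carry the second of the equal columns leftwards until it stands next to the
  -- first; each costs only a sign.
  det-equalColumns : ∀ {m} (j : Fin m) → EqualColumnsVanish j
  det-equalColumns {suc m} = <-weakInduction EqualColumnsVanish det-equalColumns₀₁ step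
    where
    step : ∀ j → EqualColumnsVanish (Fin.inject₁ j) → EqualColumnsVanish (suc j)
    step j ih M e = begin
      det (suc (suc m)) M      ≈⟨ -‿involutive _ ⟨
      - - det (suc (suc m)) M  ≈⟨ -‿cong (det-swap (suc j) M) ⟨
      - det (suc (suc m)) M′   ≈⟨ -‿cong (ih M′ λ r →
                                   trans (e r) (reflexive (cong (M r ∘ suc) (≡.sym (swap-inject₁ j))))) ⟩
      - 0#                     ≈⟨ -0#≈0# ⟩
      0#                       ∎
      where
      M′ : Matrix (suc (suc m))
      M′ r c = M r (swap (suc j) c)

  -- Linearity of the determinant in its first column

  infixr 5 _◂_
  _◂_ : ∀ {m} → (Fin (suc m) → Carrier) → (Fin (suc m) → Fin m → Carrier) → Matrix (suc m)
  (v ◂ N) r zero    = v r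
  (v ◂ N) r (suc c) = N r c

  det◂ : ∀ {m} → (Fin (suc m) → Fin m → Carrier) → (Fin (suc m) → Carrier) → Carrier
  det◂ {m} N v = det (suc m) (v ◂ N)

  dropColumn : ∀ {m} → (Fin (suc (suc m)) → Fin (suc m) → Carrier) →
               Fin (suc m) → Fin (suc m) → Fin m → Carrier
  dropColumn N k r c = N (suc r) (punchIn k c)

  minor◂ : ∀ {m} (N : Fin (suc (suc m)) → Fin (suc m) → Carrier) v k →
           det (suc m) (minor (v ◂ N) (suc k)) ≈ det◂ (dropColumn N k) (v ∘ suc)
  minor◂ {m} N v k = det-cong (suc m) {minor (v ◂ N) (suc k)} {(v ∘ suc) ◂ dropColumn N k}
    λ { r zero → refl ; r (suc c) → refl }

  -- The first column enters the leading term through its top entry, and every later term through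
  -- the first column of a minor, where induction applies. The form a u + v treats additivity and
  -- scaling in one induction.
  det◂-linear : ∀ {m} (N : Fin (suc m) → Fin m → Carrier) a u v →
                det◂ N (λ r → a * u r + v r) ≈ a * det◂ N u + det◂ N v
  det◂-linear {m} N a u v = begin
    det◂ N w
      ≈⟨ laplace (w ◂ N) ⟩
    w zero * d + sum (λ k → term (w ◂ N) (suc k))
      ≈⟨ +-congˡ (sum-cong-≋ (laterTerm N)) ⟩
    (a * u zero + v zero) * d + sum (λ k → a * term (u ◂ N) (suc k) + term (v ◂ N) (suc k))
      ≈⟨ +-congˡ (∑-distrib-+ (λ k → a * term (u ◂ N) (suc k)) (λ k → term (v ◂ N) (suc k))) ⟩
    (a * u zero + v zero) * d + (sum (λ k → a * term (u ◂ N) (suc k)) + sum (λ k → term (v ◂ N) (suc k)))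
      ≈⟨ +-congˡ (+-congʳ (*-distribˡ-sum a (λ k → term (u ◂ N) (suc k)))) ⟨
    (a * u zero + v zero) * d + (a * sum (λ k → term (u ◂ N) (suc k)) + sum (λ k → term (v ◂ N) (suc k)))
      ≈⟨ solve 6 (λ a x y d s t → ((a :* x :+ y) :* d :+ (a :* s :+ t)) := (a :* (x :* d :+ s) :+ (y :* d :+ t)))
           refl a (u zero) (v zero) d _ _ ⟩
    a * sum (term (u ◂ N)) + sum (term (v ◂ N))
      ≈⟨ +-cong (*-congˡ (laplace (u ◂ N))) (laplace (v ◂ N)) ⟨
    a * det◂ N u + det◂ N v ∎
    where
    w : Fin (suc m) → Carrier
    w r = a * u r + v r
    d = det m (minor (u ◂ N) zero)

    laterTerm : ∀ {m} (N : Fin (suc m) → Fin m → Carrier) {u v} (k : Fin m) →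
                term ((λ r → a * u r + v r) ◂ N) (suc k)
                ≈ a * term (u ◂ N) (suc k) + term (v ◂ N) (suc k)
    laterTerm {suc m} N {u} {v} k = trans
      (alt-cong (suc (toℕ k)) (trans
        (*-congˡ (trans (minor◂ N _ k) (trans (det◂-linear (dropColumn N k) a (u ∘ suc) (v ∘ suc))
          (sym (+-cong (*-congˡ (minor◂ N u k)) (minor◂ N v k))))))
        (solve 4 (λ x a s t → (x :* (a :* s :+ t)) := (a :* (x :* s) :+ x :* t)) refl (N zero k) a _ _)))
      (alt-linear (suc (toℕ k)) a _ _)

  det◂-cong : ∀ {m} (N : Fin (suc m) → Fin m → Carrier) {u v} → (∀ r → u r ≈ v r) →
              det◂ N u ≈ det◂ N v
  det◂-cong {m} N {u} {v} e = det-cong (suc m) {u ◂ N} {v ◂ N} λ { r zero → e r ; r (suc c) → refl }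

  det◂-zero : ∀ {m} (N : Fin (suc m) → Fin m → Carrier) → det◂ N (λ _ → 0#) ≈ 0#
  det◂-zero N = begin
    det◂ N (λ _ → 0#)
      ≈⟨ det◂-cong N (λ r → sym (trans (+-identityʳ _) (zeroʳ _))) ⟩
    det◂ N (λ _ → - 1# * 0# + 0#)
      ≈⟨ det◂-linear N (- 1#) (λ _ → 0#) (λ _ → 0#) ⟩
    - 1# * det◂ N (λ _ → 0#) + det◂ N (λ _ → 0#)
      ≈⟨ +-congʳ (-1*x≈-x _) ⟩
    - det◂ N (λ _ → 0#) + det◂ N (λ _ → 0#)
      ≈⟨ -‿inverseˡ _ ⟩
    0# ∎

  det◂-sum : ∀ {m k} (N : Fin (suc m) → Fin m → Carrier) (a : Fin k → Carrier)
             (u : Fin k → Fin (suc m) → Carrier) →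
             det◂ N (λ r → sum (λ c → a c * u c r)) ≈ sum (λ c → a c * det◂ N (u c))
  det◂-sum {k = zero}  N a u = det◂-zero N
  det◂-sum {k = suc k} N a u = trans (det◂-linear N (a zero) (u zero) _)
    (+-congˡ (det◂-sum N (a ∘ suc) (u ∘ suc)))

  -- As in Cramer's rule, replace the first column by the combination of all columns with
  -- coefficients v. Columns other than the first add only determinants with a repeated column,
  -- while the combination itself is zero.
  kernel⇒det : ∀ {m} (M : Matrix (suc m)) (v : Fin (suc m) → Carrier) →
               (∀ r → sum (λ c → v c * M r c) ≈ 0#) → v zero * det (suc m) M ≈ 0#
  kernel⇒det {m} M v ker = begin
    v zero * det (suc m) M
      ≈⟨ *-congˡ (det-cong (suc m) {M} {(λ r → M r zero) ◂ N}
           λ { r zero → refl ; r (suc c) → refl }) ⟩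
    v zero * det◂ N (λ r → M r zero)
      ≈⟨ +-identityʳ _ ⟨
    v zero * det◂ N (λ r → M r zero) + 0#
      ≈⟨ +-congˡ (sum-zero {m} λ c → trans (*-congˡ {v (suc c)}
           (det-equalColumns c ((λ r → M r (suc c)) ◂ N) (λ r → refl))) (zeroʳ _)) ⟨
    sum (λ c → v c * det◂ N (λ r → M r c))
      ≈⟨ det◂-sum N v (λ c r → M r c) ⟨
    det◂ N (λ r → sum (λ c → v c * M r c))
      ≈⟨ det◂-cong N ker ⟩
    det◂ N (λ _ → 0#)
      ≈⟨ det◂-zero N ⟩
    0# ∎
    where
    N : Fin (suc m) → Fin m → Carrier
    N r c = M r (suc c)

  -- A group ring may have zero divisors, so the kernel vector must have an invertible entry, not
  -- just a nonzero one. The argument in `Fin m` excludes the empty matrix, whose determinant is 1.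
  unitKernel⇒det≈0 : ∀ {m} → Fin m → (M : Matrix m) (u v : Fin m → Carrier) →
                     (∀ c → u c * v c ≈ 1#) → (∀ r → sum (λ c → v c * M r c) ≈ 0#) →
                     det m M ≈ 0#
  unitKernel⇒det≈0 {suc m} _ M u v uv≈1 ker = begin
    det (suc m) M                       ≈⟨ *-identityˡ _ ⟨
    1# * det (suc m) M                  ≈⟨ *-congʳ (uv≈1 zero) ⟨
    u zero * v zero * det (suc m) M     ≈⟨ *-assoc _ _ _ ⟩
    u zero * (v zero * det (suc m) M)   ≈⟨ *-congˡ (kernel⇒det M v ker) ⟩
    u zero * 0#                         ≈⟨ zeroʳ _ ⟩
    0#                                  ∎

  module Homomorphism {A : Set} (opsA : RingOps A) (f : A → Carrier)
                      (hom : IsRingHom opsA R f) where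
    open IsRingHom hom
    open RingOps opsA using () renaming (_*ᵣ_ to _*ₐ_)
    private module A = DetDefs opsA

    f-sum : ∀ {m} (g : Fin m → A) → f (A.sumFin g) ≈ sumFin (f ∘ g)
    f-sum {zero}  g = 0-homo
    f-sum {suc m} g = trans (+-homo _ _) (+-congˡ (f-sum (g ∘ suc)))

    f-alt : ∀ k x → f (A.alt k x) ≈ alt k (f x)
    f-alt zero    x = refl
    f-alt (suc k) x = trans (neg-homo _) (-‿cong (f-alt k x))

    det-hom : ∀ m (M : Fin m → Fin m → A) → f (A.det m M) ≈ det m (λ r c → f (M r c))
    det-hom zero    M = 1-homo
    det-hom (suc m) M = begin
      f (A.sumFin termA)                ≈⟨ f-sum termA ⟩
      sumFin (f ∘ termA)                ≡⟨ sumFin≡sum (f ∘ termA) ⟩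
      sum (f ∘ termA)                   ≈⟨ sum-cong-≋ {suc m} (λ j → trans (f-alt (toℕ j) _)
                                             (alt-cong (toℕ j) (trans (*-homo (M zero j) _)
                                             (*-congˡ (det-hom m (λ r c → M (suc r) (punchIn j c))))))) ⟩
      sum (term fM)                     ≈⟨ laplace fM ⟨
      det (suc m) fM                    ∎
      where
      fM : Matrix (suc m)
      fM r c = f (M r c)
      termA : Fin (suc m) → A
      termA j = A.alt (toℕ j) (M zero j *ₐ A.det m (λ r c → M (suc r) (punchIn j c)))

-- Group rings

module GroupLaws (Γ : FinAbGroup) where
  open FinAbGroup Γ

  abelianGroup : AbelianGroup 0ℓ 0ℓ
  abelianGroup = record { isAbelianGroup = isAbelianGroup }

  open AbelianGroup abelianGroup public
    using (assoc; comm; identityˡ; identityʳ; inverseˡ; commutativeMonoid)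
  open import Algebra.Properties.AbelianGroup abelianGroup public
  open import Algebra.Properties.CommutativeMonoid.Mult commutativeMonoid public
    using (×-assocˡ) renaming (_×_ to _⋆_)

  ·≡⋆ : ∀ k a → k · a ≡ k ⋆ a
  ·≡⋆ zero    a = ≡.refl
  ·≡⋆ (suc k) a = cong (a ⊕_) (·≡⋆ k a)

  ·-assoc : ∀ j k g → (j ℕ.* k) · g ≡ j · (k · g)
  ·-assoc j k g = ≡.trans (·≡⋆ (j ℕ.* k) g) (≡.trans (≡.sym (×-assocˡ g j k))
    (≡.sym (≡.trans (·≡⋆ j (k · g)) (cong (j ⋆_) (·≡⋆ k g)))))

  ⊝-⊕ : ∀ x y → (x ⊝ y) ⊕ y ≡ x
  ⊝-⊕ x y = //-rightDividesˡ y x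

  ⊕-⊝ : ∀ x y → (x ⊕ y) ⊝ y ≡ x
  ⊕-⊝ x y = //-rightDividesʳ y x

  ⊝-⊝ : ∀ x y → x ⊝ (x ⊝ y) ≡ y
  ⊝-⊝ x y = ≡.trans (cong (x ⊕_) (⁻¹-anti-homo‿- x y))
    (≡.trans (comm x (y ⊝ x)) (⊝-⊕ y x))

  translate : Fin n → Permutation n n
  translate z = permutation (_⊕ z) (_⊝ z) (λ y → ⊝-⊕ y z) (λ y → ⊕-⊝ y z)

  reflect : Fin n → Permutation n n
  reflect x = permutation (x ⊝_) (x ⊝_) (⊝-⊝ x) (⊝-⊝ x)

  ⊝-⊕-assoc : ∀ x y z → x ⊝ (y ⊕ z) ≡ (x ⊝ z) ⊝ y
  ⊝-⊕-assoc x y z = ≡.trans (cong (x ⊕_) (⁻¹-anti-homo-∙ y z)) (≡.sym (assoc x (⊖ z) (⊖ y)))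

  -- Translation by g permutes the group, so the sum of all elements is unchanged when n copies of g
  -- are added to it.
  n·g≡𝟘 : ∀ g → n · g ≡ 𝟘
  n·g≡𝟘 g = ≡.trans (·≡⋆ n g) (identityʳ-unique total (n ⋆ g) (begin
    total ⊕ (n ⋆ g)                ≡⟨ cong (total ⊕_) (sum-replicate n) ⟨
    total ⊕ sum {n} (λ _ → g)      ≡⟨ ∑-distrib-+ (λ x → x) (λ _ → g) ⟨
    sum (λ x → x ⊕ g)              ≡⟨ sum-permute (λ x → x) (translate g) ⟨
    total                          ∎))
    where
    open import Algebra.Properties.CommutativeMonoid.Sum commutativeMonoid
    open ≡.≡-Reasoning
    total = sum (λ x → x)

  Annihilates : ℕ → Set
  Annihilates e = ∀ g → e · g ≡ 𝟘

module GroupRing (K : CommutativeRing 0ℓ 0ℓ) (Γ : FinAbGroup) where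
  open FinAbGroup Γ
  open GroupLaws Γ using (translate; reflect; ⊝-⊝; ⊝-⊕; ⊕-⊝; ⊝-⊕-assoc)
  private
    module Γ = GroupLaws Γ
    module K = CommutativeRing K
  open K using (0#; 1#; _+_; _*_; -_; _≈_; refl; sym; trans; reflexive; +-congˡ; *-congˡ; *-congʳ; zeroˡ; zeroʳ)
  open FiniteSums K using (sum-single)
  open import Algebra.Properties.Semiring.Sum K.semiring
  open import Relation.Binary.Reasoning.Setoid K.setoid

  Carrier : Set
  Carrier = Fin n → K.Carrier

  _≋_ : Carrier → Carrier → Set
  f ≋ g = ∀ x → f x ≈ g x

  _✶_ : Carrier → Carrier → Carrier
  (f ✶ g) x = sum (λ y → f y * g (x ⊝ y))

  mono : K.Carrier → Fin n → Carrier
  mono c g x with x Fin.≟ g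
  ... | yes _ = c
  ... | no  _ = 0#

  mono-at : ∀ c {g x} → x ≡ g → mono c g x ≈ c
  mono-at c {g} {x} e with x Fin.≟ g
  ... | yes _ = refl
  ... | no ne = ⊥-elim (ne e)

  mono-off : ∀ c {g x} → x ≢ g → mono c g x ≈ 0#
  mono-off c {g} {x} ne with x Fin.≟ g
  ... | yes e = ⊥-elim (ne e)
  ... | no _  = refl

  ✶-mono : ∀ f c g x → (f ✶ mono c g) x ≈ f (x ⊝ g) * c
  ✶-mono f c g x = begin
    sum (λ y → f y * mono c g (x ⊝ y))
      ≈⟨ sum-single (x ⊝ g) _ (λ y ne → trans (*-congˡ (mono-off c λ e →
           ne (≡.trans (≡.sym (⊝-⊝ x y)) (cong (x ⊝_) e)))) (zeroʳ _)) ⟩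
    f (x ⊝ g) * mono c g (x ⊝ (x ⊝ g))
      ≈⟨ *-congˡ (mono-at c (⊝-⊝ x g)) ⟩
    f (x ⊝ g) * c ∎

  mono-cong : ∀ {c d} → c ≈ d → ∀ g → mono c g ≋ mono d g
  mono-cong e g x with x Fin.≟ g
  ... | yes _ = e
  ... | no  _ = refl

  mono-+ : ∀ c d g → mono (c + d) g ≋ (λ x → mono c g x + mono d g x)
  mono-+ c d g x with x Fin.≟ g
  ... | yes _ = refl
  ... | no  _ = sym (K.+-identityʳ _)

  mono-neg : ∀ c g → mono (- c) g ≋ (λ x → - mono c g x)
  mono-neg c g x with x Fin.≟ g
  ... | yes _ = refl
  ... | no  _ = sym -0#≈0#
    where open import Algebra.Properties.Ring K.ring using (-0#≈0#)

  mono-zero : ∀ g → mono 0# g ≋ (λ _ → 0#)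
  mono-zero g x with x Fin.≟ g
  ... | yes _ = refl
  ... | no  _ = refl

  mono-✶ : ∀ c d a b → (mono c a ✶ mono d b) ≋ mono (c * d) (a ⊕ b)
  mono-✶ c d a b x with x Fin.≟ (a ⊕ b)
  ... | yes e = trans (✶-mono (mono c a) d b x)
          (*-congʳ (mono-at c (≡.trans (cong (_⊝ b) e) (⊕-⊝ a b))))
  ... | no ne = trans (✶-mono (mono c a) d b x) (trans
          (*-congʳ (mono-off c λ e → ne (≡.trans (≡.sym (⊝-⊕ x b)) (cong (_⊕ b) e)))) (zeroˡ _))

  ✶-cong : ∀ {f f′ g g′} → f ≋ f′ → g ≋ g′ → (f ✶ g) ≋ (f′ ✶ g′)
  ✶-cong e e′ x = sum-cong-≋ (λ y → K.*-cong (e y) (e′ (x ⊝ y)))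

  ✶-comm : ∀ f g → (f ✶ g) ≋ (g ✶ f)
  ✶-comm f g x = begin
    sum (λ y → f y * g (x ⊝ y))              ≈⟨ sum-permute _ (reflect x) ⟩
    sum (λ y → f (x ⊝ y) * g (x ⊝ (x ⊝ y)))  ≈⟨ sum-cong-≋ (λ y → trans
                                                  (*-congˡ (reflexive (cong g (⊝-⊝ x y)))) (K.*-comm _ _)) ⟩
    sum (λ y → g y * f (x ⊝ y))              ∎

  ✶-assoc : ∀ f g h → ((f ✶ g) ✶ h) ≋ (f ✶ (g ✶ h))
  ✶-assoc f g h x = begin
    sum (λ y → sum (λ z → f z * g (y ⊝ z)) * h (x ⊝ y))
      ≈⟨ sum-cong-≋ (λ y → *-distribʳ-sum (h (x ⊝ y)) (λ z → f z * g (y ⊝ z))) ⟩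
    sum (λ y → sum (λ z → f z * g (y ⊝ z) * h (x ⊝ y)))
      ≈⟨ ∑-comm (λ y z → f z * g (y ⊝ z) * h (x ⊝ y)) ⟩
    sum (λ z → sum (λ y → f z * g (y ⊝ z) * h (x ⊝ y)))
      ≈⟨ sum-cong-≋ (λ z → begin
           sum (λ y → f z * g (y ⊝ z) * h (x ⊝ y))
             -- The substitution y = w + z turns the inner sum into the convolution of g and h at x
             -- - z.
             ≈⟨ sum-permute (λ y → f z * g (y ⊝ z) * h (x ⊝ y)) (translate z) ⟩
           sum (λ w → f z * g ((w ⊕ z) ⊝ z) * h (x ⊝ (w ⊕ z)))
             ≈⟨ sum-cong-≋ (λ w → trans (K.*-assoc _ _ _) (*-congˡ (reflexive
                  (≡.cong₂ (λ u v → g u * h v) (⊕-⊝ w z) (⊝-⊕-assoc x w z))))) ⟩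
           sum (λ w → f z * (g w * h ((x ⊝ z) ⊝ w)))
             ≈⟨ *-distribˡ-sum (f z) (λ w → g w * h ((x ⊝ z) ⊝ w)) ⟨
           f z * sum (λ w → g w * h ((x ⊝ z) ⊝ w)) ∎) ⟩
    sum (λ z → f z * sum (λ w → g w * h ((x ⊝ z) ⊝ w))) ∎

  one : Carrier
  one = mono 1# 𝟘

  ✶-identityʳ : ∀ f → (f ✶ one) ≋ f
  ✶-identityʳ f x = begin
    (f ✶ one) x       ≈⟨ ✶-mono f 1# 𝟘 x ⟩
    f (x ⊝ 𝟘) * 1#    ≈⟨ K.*-identityʳ _ ⟩
    f (x ⊝ 𝟘)         ≡⟨ cong f (≡.trans (cong (x ⊕_) Γ.ε⁻¹≈ε) (Γ.identityʳ x)) ⟩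
    f x               ∎

  ✶-distribʳ : ∀ f g h → ((λ x → g x + h x) ✶ f) ≋ (λ x → (g ✶ f) x + (h ✶ f) x)
  ✶-distribʳ f g h x = trans (sum-cong-≋ (λ y → K.distribʳ (f (x ⊝ y)) (g y) (h y)))
    (∑-distrib-+ (λ y → g y * f (x ⊝ y)) (λ y → h y * f (x ⊝ y)))

  ✶-distribˡ : ∀ f g h → (f ✶ (λ x → g x + h x)) ≋ (λ x → (f ✶ g) x + (f ✶ h) x)
  ✶-distribˡ f g h x = trans (sum-cong-≋ (λ y → K.distribˡ (f y) (g (x ⊝ y)) (h (x ⊝ y))))
    (∑-distrib-+ (λ y → f y * g (x ⊝ y)) (λ y → f y * h (x ⊝ y)))

  groupRing : CommutativeRing 0ℓ 0ℓ
  groupRing = record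
    { Carrier = Carrier
    ; _≈_ = _≋_
    ; _+_ = λ f g x → f x + g x
    ; _*_ = _✶_
    ; -_  = λ f x → - f x
    ; 0#  = λ _ → 0#
    ; 1#  = one
    ; isCommutativeRing = record
      { isRing = record
        { +-isAbelianGroup = Pointwise.isAbelianGroup (Fin n) K.+-isAbelianGroup
        ; *-cong = ✶-cong
        ; *-assoc = ✶-assoc
        ; *-identity = (λ f x → trans (✶-comm one f x) (✶-identityʳ f x)) , ✶-identityʳ
        ; distrib = ✶-distribˡ , ✶-distribʳ
        }
      ; *-comm = ✶-comm
      }
    }
    where import Algebra.Construct.Pointwise as Pointwise

  private module R = CommutativeRing groupRing
  open import Algebra.Properties.Semiring.Sum R.semiring using () renaming (sum to sumR)
  open import Algebra.Properties.Semiring.Exp R.semiring using () renaming (_^_ to _^ᴿ_)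
  open import Algebra.Properties.Semiring.Exp K.semiring using (_^_)

  sumR-at : ∀ {m} (F : Fin m → Carrier) x → sumR F x ≈ sum (λ i → F i x)
  sumR-at {zero}  F x = refl
  sumR-at {suc m} F x = +-congˡ (sumR-at (F ∘ suc) x)

  -- Splits an element into monomials, whose powers are explicit; this makes additive maps such as
  -- Frobenius computable.
  mono-expansion : ∀ f → f ≋ sumR (λ g → mono (f g) g)
  mono-expansion f x = sym (begin
    sumR (λ g → mono (f g) g) x  ≈⟨ sumR-at (λ g → mono (f g) g) x ⟩
    sum (λ g → mono (f g) g x)   ≈⟨ sum-single x _ (λ g ne → mono-off (f g) (ne ∘ ≡.sym)) ⟩
    mono (f x) x x               ≈⟨ mono-at (f x) {x} ≡.refl ⟩
    f x                          ∎)

  mono-^ : ∀ c g k → (mono c g ^ᴿ k) ≋ mono (c ^ k) (k · g)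
  mono-^ c g zero    x = refl
  mono-^ c g (suc k) x = trans (✶-cong {f = mono c g} (λ _ → refl) (mono-^ c g k) x)
    (mono-✶ c (c ^ k) g (k · g) x)

-- The Frobenius map in prime characteristic

prime∤! : ∀ {p} → Prime p → ∀ k → k < p → ¬ (p ∣ k !)
prime∤! {p} pr zero    k<p d = >⇒∤ k<p′ d
  where
  k<p′ : 1 < p
  k<p′ = ℕ.≤∧≢⇒< k<p λ { ≡.refl → ¬prime[1] pr }
prime∤! pr (suc k) k<p d with euclidsLemma (suc k) (k !) pr d
... | inj₁ e = >⇒∤ k<p e
... | inj₂ e = prime∤! pr k (ℕ.<-trans (ℕ.n<1+n k) k<p) e

-- The prime divides p! = C(p,k) k! (p - k)!, but neither factorial on the right, as both k and p -
-- k are smaller than p.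
prime∣choose : ∀ {p} → Prime p → ∀ k → 0 < k → k < p → p ∣ p choose k
prime∣choose {zero}  pr k 0<k ()
prime∣choose {suc q} pr k 0<k k<p
  with euclidsLemma (suc q choose k) (k ! ℕ.* (suc q ∸ k) !) pr p∣C*k![p-k]!
  where
  C*k![p-k]! : (suc q choose k) ℕ.* (k ! ℕ.* (suc q ∸ k) !) ≡ suc q !
  C*k![p-k]! = ≡.trans (cong (ℕ._* (k ! ℕ.* (suc q ∸ k) !)) (nCk≡n!/k![n-k]! (ℕ.<⇒≤ k<p)))
    (m/n*n≡m ⦃ k ℕ.!* (suc q ∸ k) !≢0 ⦄ (k![n∸k]!∣n! (ℕ.<⇒≤ k<p)))
  p∣C*k![p-k]! : suc q ∣ (suc q choose k) ℕ.* (k ! ℕ.* (suc q ∸ k) !)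
  p∣C*k![p-k]! = ≡.subst (suc q ∣_) (≡.sym C*k![p-k]!) (m∣m*n (q !))
... | inj₁ d = d
... | inj₂ d with euclidsLemma (k !) ((suc q ∸ k) !) pr d
...   | inj₁ e = ⊥-elim (prime∤! pr k k<p e)
...   | inj₂ e = ⊥-elim (prime∤! pr (suc q ∸ k) (ℕ.∸-monoʳ-< 0<k (ℕ.<⇒≤ k<p)) e)

module Characteristic (R : CommutativeRing 0ℓ 0ℓ) where
  open CommutativeRing R hiding (zero)
  open import Algebra.Properties.Ring ring using (-‿+-comm; -1*x≈-x)
  open import Algebra.Properties.Group +-group using (\\-leftDividesˡ; //-rightDividesˡ)
  open import Algebra.Properties.Semiring.Sum semiring
  open import Algebra.Properties.Semiring.Mult semiring renaming (_×_ to _×ᴿ_)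
  open import Algebra.Properties.Semiring.Exp semiring
  open import Algebra.Properties.CommutativeSemiring.Binomial commutativeSemiring
  open import Relation.Binary.Reasoning.Setoid setoid

  module _ {p} (pr : Prime p) (char : ∀ x → p ×ᴿ x ≈ 0#) where

    ∣⇒×≈0 : ∀ {k} → p ∣ k → ∀ x → k ×ᴿ x ≈ 0#
    ∣⇒×≈0 (divides q ≡.refl) x = begin
      (q ℕ.* p) ×ᴿ x  ≈⟨ ×-assocˡ x q p ⟨
      q ×ᴿ (p ×ᴿ x)    ≈⟨ ×-congʳ q (char x) ⟩
      q ×ᴿ 0#         ≈⟨ sum-replicate q ⟨
      sum {q} _      ≈⟨ sum-replicate-zero q ⟩
      0#             ∎

  -- Of the binomial terms only the two outermost survive, all inner coefficients being multiples of
  -- p.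
  frobenius-+ : ∀ {p} → Prime p → (∀ x → p ×ᴿ x ≈ 0#) → ∀ x y → (x + y) ^ p ≈ x ^ p + y ^ p
  frobenius-+ {zero}  pr char x y = ⊥-elim (¬prime[0] pr)
  frobenius-+ {suc q} pr char x y = begin
    (x + y) ^ p
      ≈⟨ theorem p x y ⟩
    t zero + sum (λ k → t (suc k))
      ≈⟨ +-congˡ (sum-init-last (λ k → t (suc k))) ⟩
    t zero + (sum (λ k → t (suc (Fin.inject₁ k))) + t (suc (Fin.fromℕ q)))
      ≈⟨ +-cong first (+-cong (trans (sum-cong-≋ middle) (sum-replicate-zero q)) last) ⟩
    y ^ p + (0# + x ^ p)
      ≈⟨ +-congˡ (+-identityˡ _) ⟩
    y ^ p + x ^ p
      ≈⟨ +-comm _ _ ⟩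
    x ^ p + y ^ p ∎
    where
    p = suc q
    t = binomialTerm x y p
    first : t zero ≈ y ^ p
    first = trans (+-identityʳ _) (*-identityˡ _)
    middle : ∀ k → t (suc (Fin.inject₁ k)) ≈ 0#
    middle k = ∣⇒×≈0 pr char (prime∣choose pr (suc (toℕ (Fin.inject₁ k))) (s≤s z≤n)
      (s≤s (≡.subst (_< q) (≡.sym (toℕ-inject₁ k)) (toℕ<n k)))) _
    last : t (suc (Fin.fromℕ q)) ≈ x ^ p
    last = begin
      (p choose suc (toℕ (Fin.fromℕ q))) ×ᴿ (x ^ suc (toℕ (Fin.fromℕ q)) * y ^ (q ∸ toℕ (Fin.fromℕ q)))
        ≡⟨ cong (λ j → (p choose suc j) ×ᴿ (x ^ suc j * y ^ (q ∸ j))) (toℕ-fromℕ q) ⟩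
      (p choose p) ×ᴿ (x ^ p * y ^ (q ∸ q))
        ≡⟨ ≡.cong₂ (λ i j → i ×ᴿ (x ^ p * y ^ j)) (nCn≡1 p) (ℕ.n∸n≡0 q) ⟩
      1 ×ᴿ (x ^ p * 1#)
        ≈⟨ +-identityʳ _ ⟩
      x ^ p * 1#
        ≈⟨ *-identityʳ _ ⟩
      x ^ p ∎

  0^prime : ∀ {p} → Prime p → 0# ^ p ≈ 0#
  0^prime {zero}  pr = ⊥-elim (¬prime[0] pr)
  0^prime {suc q} pr = zeroˡ _

  frobenius-sum : ∀ {p} → Prime p → (∀ x → p ×ᴿ x ≈ 0#) →
                  ∀ {m} (f : Fin m → Carrier) → sum f ^ p ≈ sum (λ i → f i ^ p)
  frobenius-sum pr char {zero}  f = 0^prime pr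
  frobenius-sum pr char {suc m} f =
    trans (frobenius-+ pr char _ _) (+-congˡ (frobenius-sum pr char (f ∘ suc)))

  -- For an exponent k + 2, the p-th power of y ^ (k + 1) contains the factor y ^ (k + 2), since p
  -- is at least 2. It therefore vanishes, and injectivity lowers the exponent by one.
  frobeniusInjective⇒reduced : ∀ {p} → Prime p → (∀ x → x ^ p ≈ 0# → x ≈ 0#) →
                               ∀ m {y} → y ^ m ≈ 0# → y ≈ 0#
  frobeniusInjective⇒reduced {zero}        pr inj m e = ⊥-elim (¬prime[0] pr)
  frobeniusInjective⇒reduced {suc zero}    pr inj m e = ⊥-elim (¬prime[1] pr)
  -- With exponent 0 the hypothesis reads 1 = 0, and the whole ring collapses.
  frobeniusInjective⇒reduced {suc (suc q)} pr inj zero {y} e = begin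
    y        ≈⟨ *-identityʳ y ⟨
    y * 1#   ≈⟨ *-congˡ e ⟩
    y * 0#   ≈⟨ zeroʳ y ⟩
    0#       ∎
  frobeniusInjective⇒reduced {suc (suc q)} pr inj (suc zero) {y} e = trans (sym (*-identityʳ y)) e
  frobeniusInjective⇒reduced {suc (suc q)} pr inj (suc (suc k)) {y} e =
    frobeniusInjective⇒reduced pr inj (suc k) (inj (y ^ suc k) (begin
      (y ^ suc k) ^ suc (suc q)                           ≈⟨ ^-assocʳ y (suc k) (suc (suc q)) ⟩
      y ^ (suc k ℕ.* suc (suc q))                         ≈⟨ ^-congʳ y (split k q) ⟩
      y ^ (suc (suc k) ℕ.+ (k ℕ.+ suc k ℕ.* q))           ≈⟨ ^-homo-* y (suc (suc k)) _ ⟩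
      y ^ suc (suc k) * y ^ (k ℕ.+ suc k ℕ.* q)           ≈⟨ *-congʳ e ⟩
      0# * y ^ (k ℕ.+ suc k ℕ.* q)                        ≈⟨ zeroˡ _ ⟩
      0#                                                  ∎))
    where
    split : ∀ k q → suc k ℕ.* suc (suc q) ≡ suc (suc k) ℕ.+ (k ℕ.+ suc k ℕ.* q)
    split = solve-∀-ℕ

  -- Put d = h - c. Frobenius is additive and fixes c, so the contributions of c cancel and d ^ p -
  -- d remains, which has the factor d.
  frobenius-fixed⇒∣ : ∀ {p} → Prime p → (∀ x → p ×ᴿ x ≈ 0#) → ∀ h c → c ^ p ≈ c →
                      ∃[ w ] h ^ p - h ≈ (h - c) * w
  frobenius-fixed⇒∣ {zero}  pr char h c e = ⊥-elim (¬prime[0] pr)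
  frobenius-fixed⇒∣ {suc q} pr char h c e = d ^ q - 1# , (begin
    h ^ p - h                    ≈⟨ +-cong (^-congˡ p h≈d+c) (-‿cong h≈d+c) ⟩
    (d + c) ^ p - (d + c)        ≈⟨ +-cong (trans (frobenius-+ pr char d c) (+-congˡ e)) (sym (-‿+-comm d c)) ⟩
    (d ^ p + c) + (- d + - c)    ≈⟨ +-congˡ (+-comm _ _) ⟩
    (d ^ p + c) + (- c + - d)    ≈⟨ +-assoc _ _ _ ⟩
    d ^ p + (c + (- c + - d))    ≈⟨ +-congˡ (\\-leftDividesˡ c (- d)) ⟩
    d * d ^ q + - d              ≈⟨ +-congˡ (trans (sym (-1*x≈-x d)) (*-comm _ _)) ⟩
    d * d ^ q + d * - 1#         ≈⟨ distribˡ d _ _ ⟨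
    d * (d ^ q - 1#)             ∎)
    where
    p = suc q
    d = h - c
    h≈d+c : h ≈ d + c
    h≈d+c = sym (//-rightDividesˡ c h)

-- Eisenstein integers modulo p

-- Complex conjugation: it sends ω to ω² = -1 - ω.
conj : ℤω → ℤω
conj ⟨ a , b ⟩ = ⟨ a ℤ.- b , ℤ.- b ⟩

conj-involutive : ∀ x → conj (conj x) ≡ x
conj-involutive ⟨ a , b ⟩ = ≡.cong₂ ⟨_,_⟩ (eq₁ a b) (ℤ.neg-involutive b)
  where
  eq₁ : ∀ a b → (a ℤ.- b) ℤ.- (ℤ.- b) ≡ a
  eq₁ = solve-∀

ω : ℤω
ω = ⟨ + 0 , + 1 ⟩

*ᵣ-assoc : ∀ x y z → (x *ᵣ y) *ᵣ z ≡ x *ᵣ (y *ᵣ z)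
*ᵣ-assoc ⟨ a , b ⟩ ⟨ c , d ⟩ ⟨ e , f ⟩ = ≡.cong₂ ⟨_,_⟩ (eq₁ a b c d e f) (eq₂ a b c d e f)
  where
  eq₁ : ∀ a b c d e f → (a ℤ.* c ℤ.- b ℤ.* d) ℤ.* e ℤ.- (a ℤ.* d ℤ.+ b ℤ.* c ℤ.- b ℤ.* d) ℤ.* f
    ≡ a ℤ.* (c ℤ.* e ℤ.- d ℤ.* f) ℤ.- b ℤ.* (c ℤ.* f ℤ.+ d ℤ.* e ℤ.- d ℤ.* f)
  eq₁ = solve-∀
  eq₂ : ∀ a b c d e f → (a ℤ.* c ℤ.- b ℤ.* d) ℤ.* f ℤ.+ (a ℤ.* d ℤ.+ b ℤ.* c ℤ.- b ℤ.* d) ℤ.* e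
        ℤ.- (a ℤ.* d ℤ.+ b ℤ.* c ℤ.- b ℤ.* d) ℤ.* f
    ≡ a ℤ.* (c ℤ.* f ℤ.+ d ℤ.* e ℤ.- d ℤ.* f) ℤ.+ b ℤ.* (c ℤ.* e ℤ.- d ℤ.* f)
        ℤ.- b ℤ.* (c ℤ.* f ℤ.+ d ℤ.* e ℤ.- d ℤ.* f)
  eq₂ = solve-∀

*ᵣ-comm : ∀ x y → x *ᵣ y ≡ y *ᵣ x
*ᵣ-comm ⟨ a , b ⟩ ⟨ c , d ⟩ = ≡.cong₂ ⟨_,_⟩ (eq₁ a b c d) (eq₂ a b c d)
  where
  eq₁ : ∀ a b c d → a ℤ.* c ℤ.- b ℤ.* d ≡ c ℤ.* a ℤ.- d ℤ.* b
  eq₁ = solve-∀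
  eq₂ : ∀ a b c d → a ℤ.* d ℤ.+ b ℤ.* c ℤ.- b ℤ.* d ≡ c ℤ.* b ℤ.+ d ℤ.* a ℤ.- d ℤ.* b
  eq₂ = solve-∀

*ᵣ-identityˡ : ∀ x → 1ω *ᵣ x ≡ x
*ᵣ-identityˡ ⟨ a , b ⟩ = ≡.cong₂ ⟨_,_⟩ (eq₁ a b) (eq₂ a b)
  where
  eq₁ : ∀ a b → + 1 ℤ.* a ℤ.- + 0 ℤ.* b ≡ a
  eq₁ = solve-∀
  eq₂ : ∀ a b → + 1 ℤ.* b ℤ.+ + 0 ℤ.* a ℤ.- + 0 ℤ.* b ≡ b
  eq₂ = solve-∀

*ᵣ-distribˡ : ∀ x y z → x *ᵣ (y +ᵣ z) ≡ (x *ᵣ y) +ᵣ (x *ᵣ z)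
*ᵣ-distribˡ ⟨ a , b ⟩ ⟨ c , d ⟩ ⟨ e , f ⟩ = ≡.cong₂ ⟨_,_⟩ (eq₁ a b c d e f) (eq₂ a b c d e f)
  where
  eq₁ : ∀ a b c d e f → a ℤ.* (c ℤ.+ e) ℤ.- b ℤ.* (d ℤ.+ f)
    ≡ (a ℤ.* c ℤ.- b ℤ.* d) ℤ.+ (a ℤ.* e ℤ.- b ℤ.* f)
  eq₁ = solve-∀
  eq₂ : ∀ a b c d e f → a ℤ.* (d ℤ.+ f) ℤ.+ b ℤ.* (c ℤ.+ e) ℤ.- b ℤ.* (d ℤ.+ f)
    ≡ (a ℤ.* d ℤ.+ b ℤ.* c ℤ.- b ℤ.* d) ℤ.+ (a ℤ.* f ℤ.+ b ℤ.* e ℤ.- b ℤ.* f)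
  eq₂ = solve-∀

module Modulo (p : ℕ) where

  infix 4 _≈_

  -- Congruence is tested on the coordinates with respect to 1 and ω, so the quotient ring keeps the
  -- elements of `ℤω` as representatives.
  record _≈_ (x y : ℤω) : Set where
    constructor _,_
    field
      re≈ : + p ∣ℤ (ℤω.re x ℤ.- ℤω.re y)
      im≈ : + p ∣ℤ (ℤω.im x ℤ.- ℤω.im y)

  private
    ∣-resp : ∀ {a b} → a ≡ b → + p ∣ℤ a → + p ∣ℤ b
    ∣-resp ≡.refl d = d

    ℤ-refl : ∀ a → + p ∣ℤ (a ℤ.- a)
    ℤ-refl a = ℤ∣.divides (+ 0) (ℤ.+-inverseʳ a)

    ℤ-sym : ∀ a b → + p ∣ℤ (a ℤ.- b) → + p ∣ℤ (b ℤ.- a)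
    ℤ-sym a b d = ∣-resp (eq a b) (ℤ∣.∣m⇒∣-m d)
      where
      eq : ∀ a b → ℤ.- (a ℤ.- b) ≡ b ℤ.- a
      eq = solve-∀

    ℤ-trans : ∀ a b c → + p ∣ℤ (a ℤ.- b) → + p ∣ℤ (b ℤ.- c) → + p ∣ℤ (a ℤ.- c)
    ℤ-trans a b c d e = ∣-resp (eq a b c) (ℤ∣.∣m∣n⇒∣m+n d e)
      where
      eq : ∀ a b c → (a ℤ.- b) ℤ.+ (b ℤ.- c) ≡ a ℤ.- c
      eq = solve-∀

    ℤ-+-cong : ∀ a b c d → + p ∣ℤ (a ℤ.- b) → + p ∣ℤ (c ℤ.- d) → + p ∣ℤ ((a ℤ.+ c) ℤ.- (b ℤ.+ d))
    ℤ-+-cong a b c d x y = ∣-resp (eq a b c d) (ℤ∣.∣m∣n⇒∣m+n x y)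
      where
      eq : ∀ a b c d → (a ℤ.- b) ℤ.+ (c ℤ.- d) ≡ (a ℤ.+ c) ℤ.- (b ℤ.+ d)
      eq = solve-∀

    ℤ-neg-cong : ∀ a b → + p ∣ℤ (a ℤ.- b) → + p ∣ℤ ((ℤ.- a) ℤ.- (ℤ.- b))
    ℤ-neg-cong a b d = ∣-resp (eq a b) (ℤ∣.∣m⇒∣-m d)
      where
      eq : ∀ a b → ℤ.- (a ℤ.- b) ≡ (ℤ.- a) ℤ.- (ℤ.- b)
      eq = solve-∀

    ℤ-*-cong : ∀ a b c d → + p ∣ℤ (a ℤ.- b) → + p ∣ℤ (c ℤ.- d) → + p ∣ℤ ((a ℤ.* c) ℤ.- (b ℤ.* d))
    ℤ-*-cong a b c d x y = ∣-resp (eq a b c d) (ℤ∣.∣m∣n⇒∣m+n (ℤ∣.∣m⇒∣m*n c x) (ℤ∣.∣n⇒∣m*n b y))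
      where
      eq : ∀ a b c d → (a ℤ.- b) ℤ.* c ℤ.+ b ℤ.* (c ℤ.- d) ≡ (a ℤ.* c) ℤ.- (b ℤ.* d)
      eq = solve-∀

  ≡⇒≈ : ∀ {x y} → x ≡ y → x ≈ y
  ≡⇒≈ {x} ≡.refl = ℤ-refl (ℤω.re x) , ℤ-refl (ℤω.im x)

  *-cong : ∀ {x y u v} → x ≈ y → u ≈ v → (x *ᵣ u) ≈ (y *ᵣ v)
  *-cong {⟨ a , b ⟩} {⟨ a′ , b′ ⟩} {⟨ c , d ⟩} {⟨ c′ , d′ ⟩} (r , i) (r′ , i′) =
    ℤ-+-cong (a ℤ.* c) (a′ ℤ.* c′) (ℤ.- (b ℤ.* d)) (ℤ.- (b′ ℤ.* d′)) ac -bd ,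
    ℤ-+-cong (a ℤ.* d ℤ.+ b ℤ.* c) (a′ ℤ.* d′ ℤ.+ b′ ℤ.* c′) (ℤ.- (b ℤ.* d)) (ℤ.- (b′ ℤ.* d′))
      (ℤ-+-cong (a ℤ.* d) (a′ ℤ.* d′) (b ℤ.* c) (b′ ℤ.* c′)
        (ℤ-*-cong a a′ d d′ r i′) (ℤ-*-cong b b′ c c′ i r′)) -bd
    where
    ac = ℤ-*-cong a a′ c c′ r r′
    -bd = ℤ-neg-cong (b ℤ.* d) (b′ ℤ.* d′) (ℤ-*-cong b b′ d d′ i i′)

  ℤω/p : CommutativeRing 0ℓ 0ℓ
  ℤω/p = record
    { Carrier = ℤω ; _≈_ = _≈_ ; _+_ = _+ᵣ_ ; _*_ = _*ᵣ_ ; -_ = -ᵣ_ ; 0# = 0ω ; 1# = 1ω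
    ; isCommutativeRing = record
      { isRing = record
        { +-isAbelianGroup = record
          { isGroup = record
            { isMonoid = record
              { isSemigroup = record
                { isMagma = record
                  { isEquivalence = record
                    { refl  = ≡⇒≈ ≡.refl
                    ; sym   = λ { {x} {y} (r , i) →
                        ℤ-sym (ℤω.re x) (ℤω.re y) r , ℤ-sym (ℤω.im x) (ℤω.im y) i }
                    ; trans = λ { {x} {y} {z} (r , i) (r′ , i′) →
                        ℤ-trans (ℤω.re x) (ℤω.re y) (ℤω.re z) r r′ ,
                        ℤ-trans (ℤω.im x) (ℤω.im y) (ℤω.im z) i i′ }
                    }
                  ; ∙-cong = λ { {x} {y} {u} {v} (r , i) (r′ , i′) →
                      ℤ-+-cong (ℤω.re x) (ℤω.re y) (ℤω.re u) (ℤω.re v) r r′ ,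
                      ℤ-+-cong (ℤω.im x) (ℤω.im y) (ℤω.im u) (ℤω.im v) i i′ }
                  }
                ; assoc = λ x y z → ≡⇒≈ (≡.cong₂ ⟨_,_⟩ (ℤ.+-assoc (ℤω.re x) _ _) (ℤ.+-assoc (ℤω.im x) _ _))
                }
              ; identity = (λ x → ≡⇒≈ (≡.cong₂ ⟨_,_⟩ (ℤ.+-identityˡ _) (ℤ.+-identityˡ _)))
                         , (λ x → ≡⇒≈ (≡.cong₂ ⟨_,_⟩ (ℤ.+-identityʳ _) (ℤ.+-identityʳ _)))
              }
            ; inverse = (λ x → ≡⇒≈ (≡.cong₂ ⟨_,_⟩ (ℤ.+-inverseˡ (ℤω.re x)) (ℤ.+-inverseˡ (ℤω.im x))))
                      , (λ x → ≡⇒≈ (≡.cong₂ ⟨_,_⟩ (ℤ.+-inverseʳ (ℤω.re x)) (ℤ.+-inverseʳ (ℤω.im x))))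
            ; ⁻¹-cong = λ { {x} {y} (r , i) →
                ℤ-neg-cong (ℤω.re x) (ℤω.re y) r , ℤ-neg-cong (ℤω.im x) (ℤω.im y) i }
            }
          ; comm = λ x y → ≡⇒≈ (≡.cong₂ ⟨_,_⟩ (ℤ.+-comm (ℤω.re x) _) (ℤ.+-comm (ℤω.im x) _))
          }
        ; *-cong = *-cong
        ; *-assoc = λ x y z → ≡⇒≈ (*ᵣ-assoc x y z)
        ; *-identity = (λ x → ≡⇒≈ (*ᵣ-identityˡ x))
                     , (λ x → ≡⇒≈ (≡.trans (*ᵣ-comm x 1ω) (*ᵣ-identityˡ x)))
        ; distrib = (λ x y z → ≡⇒≈ (*ᵣ-distribˡ x y z))
                  , (λ x y z → ≡⇒≈ (≡.trans (*ᵣ-comm (y +ᵣ z) x) (≡.trans (*ᵣ-distribˡ x y z)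
                      (≡.cong₂ _+ᵣ_ (*ᵣ-comm x y) (*ᵣ-comm x z)))))
        }
      ; *-comm = λ x y → ≡⇒≈ (*ᵣ-comm x y)
      }
    }

  private module K = CommutativeRing ℤω/p
  open import Algebra.Properties.Semiring.Mult K.semiring using () renaming (_×_ to _×ᴷ_)
  open import Algebra.Properties.Semiring.Exp K.semiring
  open import Algebra.Properties.Group K.+-group using (inverseʳ-unique)
  open import Relation.Binary.Reasoning.Setoid K.setoid

  multiple : ∀ k x → k ×ᴷ x ≡ ⟨ + k ℤ.* ℤω.re x , + k ℤ.* ℤω.im x ⟩
  multiple zero    x = ≡.refl
  multiple (suc k) x = ≡.trans (cong (x +ᵣ_) (multiple k x))
    (≡.cong₂ ⟨_,_⟩ (≡.sym (ℤ.suc-* (+ k) (ℤω.re x))) (≡.sym (ℤ.suc-* (+ k) (ℤω.im x))))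

  char-p : ∀ x → (p ×ᴷ x) ≈ 0ω
  char-p x = K.trans (≡⇒≈ (multiple p x)) (p∣ (ℤω.re x) , p∣ (ℤω.im x))
    where
    p∣ : ∀ a → + p ∣ℤ (+ p ℤ.* a ℤ.- + 0)
    p∣ a = ∣-resp (≡.sym (ℤ.+-identityʳ _)) (ℤ∣.∣m⇒∣m*n a ℤ∣.∣-refl)

  ω^[r+3q] : ∀ r q → ω ^ (r ℕ.+ q ℕ.* 3) ≈ ω ^ r
  ω^[r+3q] r q = begin
    ω ^ (r ℕ.+ q ℕ.* 3)         ≈⟨ ^-homo-* ω r (q ℕ.* 3) ⟩
    (ω ^ r) *ᵣ (ω ^ (q ℕ.* 3))  ≈⟨ K.*-congˡ {ω ^ r} (cubes q) ⟩
    (ω ^ r) *ᵣ 1ω               ≈⟨ K.*-identityʳ _ ⟩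
    ω ^ r                       ∎
    where
    cubes : ∀ q → ω ^ (q ℕ.* 3) ≈ 1ω
    cubes zero    = K.refl
    -- Here `ω ^ 3` computes to `1ω`, so a left identity law removes it.
    cubes (suc q) = K.trans (^-homo-* ω 3 (q ℕ.* 3)) (K.trans (K.*-identityˡ _) (cubes q))

  ω^ : ∀ {r} k → k % 3 ≡ r → ω ^ k ≈ ω ^ r
  ω^ {r} k e = K.trans (^-congʳ ω (≡.trans (m≡m%n+[m/n]*n k 3) (cong (ℕ._+ k / 3 ℕ.* 3) e))) (ω^[r+3q] r (k / 3))

  conj≈0 : ∀ x → conj x ≈ 0ω → x ≈ 0ω
  conj≈0 ⟨ a , b ⟩ (r , i) =
    ∣-resp (eq₁ a b) (ℤ∣.∣m∣n⇒∣m-n r i) , ∣-resp (eq₂ b) (ℤ∣.∣m⇒∣-m i)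
    where
    eq₁ : ∀ a b → (a ℤ.- b ℤ.- + 0) ℤ.- (ℤ.- b ℤ.- + 0) ≡ a ℤ.- + 0
    eq₁ = solve-∀
    eq₂ : ∀ b → ℤ.- (ℤ.- b ℤ.- + 0) ≡ b ℤ.- + 0
    eq₂ = solve-∀

  module _ (pr : Prime p) where
    open Characteristic ℤω/p

    1^ : ∀ k → 1ω ^ k ≈ 1ω
    1^ zero    = K.refl
    1^ (suc k) = K.trans (K.*-identityˡ _) (1^ k)

    -- Fermat's little theorem, by induction on a: Frobenius is additive and fixes 1.
    fermat-ℕ : ∀ a → ιℤ (+ a) ^ p ≈ ιℤ (+ a)
    fermat-ℕ zero    = 0^prime pr
    fermat-ℕ (suc a) = begin
      (1ω +ᵣ ιℤ (+ a)) ^ p         ≈⟨ frobenius-+ pr char-p 1ω (ιℤ (+ a)) ⟩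
      (1ω ^ p) +ᵣ (ιℤ (+ a) ^ p)   ≈⟨ K.+-cong (1^ p) (fermat-ℕ a) ⟩
      1ω +ᵣ ιℤ (+ a)               ∎

    -- Follows from additivity alone, which avoids a case distinction on the parity of p.
    frobenius-neg : ∀ x → (-ᵣ x) ^ p ≈ (-ᵣ (x ^ p))
    frobenius-neg x = inverseʳ-unique (x ^ p) ((-ᵣ x) ^ p) (begin
      (x ^ p) +ᵣ ((-ᵣ x) ^ p)   ≈⟨ frobenius-+ pr char-p x (-ᵣ x) ⟨
      (x +ᵣ (-ᵣ x)) ^ p         ≈⟨ ^-congˡ p (K.-‿inverseʳ x) ⟩
      0ω ^ p                    ≈⟨ 0^prime pr ⟩
      0ω                        ∎)

    fermat : ∀ a → ιℤ a ^ p ≈ ιℤ a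
    fermat (+ a)    = fermat-ℕ a
    fermat -[1+ a ] = K.trans (frobenius-neg (ιℤ (+ suc a))) (K.-‿cong (fermat-ℕ (suc a)))

    -- Frobenius is a ring endomorphism fixing the integers, so the image of ω determines it; that
    -- image depends only on p modulo 3.
    frobenius-ω : ∀ x → x ^ p ≈ (ιℤ (ℤω.re x) +ᵣ (ιℤ (ℤω.im x) *ᵣ (ω ^ p)))
    frobenius-ω x@(⟨ a , b ⟩) = begin
      x ^ p
        ≈⟨ ^-congˡ p (≡⇒≈ (≡.cong₂ ⟨_,_⟩ (eq₁ a b) (eq₂ b))) ⟩
      (ιℤ a +ᵣ (ιℤ b *ᵣ ω)) ^ p
        ≈⟨ frobenius-+ pr char-p (ιℤ a) (ιℤ b *ᵣ ω) ⟩
      (ιℤ a ^ p) +ᵣ ((ιℤ b *ᵣ ω) ^ p)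
        ≈⟨ K.+-cong (fermat a) (K.trans (^-distrib-* (ιℤ b) ω p) (K.*-congʳ (fermat b))) ⟩
      ιℤ a +ᵣ (ιℤ b *ᵣ (ω ^ p)) ∎
      where
      open import Algebra.Properties.CommutativeSemiring.Exp K.commutativeSemiring using (^-distrib-*)
      eq₁ : ∀ a b → a ≡ a ℤ.+ (b ℤ.* + 0 ℤ.- + 0 ℤ.* + 1)
      eq₁ = solve-∀
      eq₂ : ∀ b → b ≡ + 0 ℤ.+ (b ℤ.* + 1 ℤ.+ + 0 ℤ.* + 0 ℤ.- + 0 ℤ.* + 1)
      eq₂ = solve-∀

    frobenius-1mod3 : p % 3 ≡ 1 → ∀ x → x ^ p ≈ x
    frobenius-1mod3 e x@(⟨ a , b ⟩) = K.trans (frobenius-ω x)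
      (K.trans (K.+-congˡ {ιℤ a} (K.*-congˡ {ιℤ b} (ω^ p e))) (≡⇒≈ (≡.cong₂ ⟨_,_⟩ (eq₁ a b) (eq₂ b))))
      where
      eq₁ : ∀ a b → a ℤ.+ (b ℤ.* + 0 ℤ.- + 0 ℤ.* + 1) ≡ a
      eq₁ = solve-∀
      eq₂ : ∀ b → + 0 ℤ.+ (b ℤ.* + 1 ℤ.+ + 0 ℤ.* + 0 ℤ.- + 0 ℤ.* + 1) ≡ b
      eq₂ = solve-∀

    frobenius-2mod3 : p % 3 ≡ 2 → ∀ x → x ^ p ≈ conj x
    frobenius-2mod3 e x@(⟨ a , b ⟩) = K.trans (frobenius-ω x)
      (K.trans (K.+-congˡ {ιℤ a} (K.*-congˡ {ιℤ b} (ω^ p e))) (≡⇒≈ (≡.cong₂ ⟨_,_⟩ (eq₁ a b) (eq₂ b))))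
      where
      -- Both coordinates of ω² are -1, which makes the image of ω its conjugate.
      eq₁ : ∀ a b → a ℤ.+ (b ℤ.* ℤ.- + 1 ℤ.- + 0 ℤ.* ℤ.- + 1) ≡ a ℤ.- b
      eq₁ = solve-∀
      eq₂ : ∀ b → + 0 ℤ.+ (b ℤ.* ℤ.- + 1 ℤ.+ + 0 ℤ.* ℤ.- + 1 ℤ.- + 0 ℤ.* ℤ.- + 1) ≡ ℤ.- b
      eq₂ = solve-∀

-- Evaluation of polynomials

module Evaluation (R : CommutativeRing 0ℓ 0ℓ) (C : ℤω → CommutativeRing.Carrier R)
                  (hom : IsRingHom ℤωOps R C) (h : CommutativeRing.Carrier R) where
  open CommutativeRing R
  open IsRingHom hom renaming (0-homo to C-0; 1-homo to C-1; +-homo to C-+; *-homo to C-*; neg-homo to C-neg)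
  open Characteristic R using (frobenius-fixed⇒∣)
  open import Algebra.Properties.Semiring.Mult semiring using () renaming (_×_ to _×ᴿ_)
  open import Algebra.Properties.Semiring.Exp semiring using (_^_)
  open import Algebra.Properties.Ring ring
  open import Relation.Binary.Reasoning.Setoid setoid
  open import Algebra.Solver.Ring.NaturalCoefficients.Default commutativeSemiring
    using (solve; _:=_; _:+_; _:*_)

  eval : List ℤω → Carrier
  eval []      = 0#
  eval (a ∷ p) = C a + h * eval p

  eval-0 : ∀ p → (∀ k → coeff p k ≡ 0ω) → eval p ≈ 0#
  eval-0 []      e = refl
  eval-0 (a ∷ p) e = begin
    C a + h * eval p  ≈⟨ +-cong (trans (reflexive (cong C (e 0))) C-0) (*-congˡ (eval-0 p (e ∘ suc))) ⟩
    0# + h * 0#       ≈⟨ +-identityˡ _ ⟩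
    h * 0#            ≈⟨ zeroʳ h ⟩
    0#                ∎

  -- The characteristic polynomial and the product of linear factors agree only coefficientwise, so
  -- their lists may differ in trailing zeros.
  eval-cong : ∀ p q → p ≈ₚ q → eval p ≈ eval q
  eval-cong []      q       e = sym (eval-0 q (≡.sym ∘ e))
  eval-cong (a ∷ p) []      e = eval-0 (a ∷ p) e
  eval-cong (a ∷ p) (b ∷ q) e =
    +-cong (reflexive (cong C (e 0))) (*-congˡ (eval-cong p q (e ∘ suc)))

  eval-padd : ∀ p q → eval (padd p q) ≈ eval p + eval q
  eval-padd []      q       = sym (+-identityˡ _)
  eval-padd (a ∷ p) []      = sym (+-identityʳ _)
  eval-padd (a ∷ p) (b ∷ q) = trans (+-cong (C-+ a b) (*-congˡ (eval-padd p q)))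
    (solve 5 (λ a b h p q → (a :+ b) :+ h :* (p :+ q) := (a :+ h :* p) :+ (b :+ h :* q))
      refl (C a) (C b) h (eval p) (eval q))

  eval-scale : ∀ a q → eval (map (a *ᵣ_) q) ≈ C a * eval q
  eval-scale a []      = sym (zeroʳ _)
  eval-scale a (b ∷ q) = trans (+-cong (C-* a b) (*-congˡ (eval-scale a q)))
    (solve 4 (λ a b h q → a :* b :+ h :* (a :* q) := a :* (b :+ h :* q)) refl (C a) (C b) h (eval q))

  eval-pmul : ∀ p q → eval (pmul p q) ≈ eval p * eval q
  eval-pmul []      q = sym (zeroˡ _)
  eval-pmul (a ∷ p) q = begin
    eval (padd (map (a *ᵣ_) q) (0ω ∷ pmul p q))
      ≈⟨ eval-padd (map (a *ᵣ_) q) (0ω ∷ pmul p q) ⟩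
    eval (map (a *ᵣ_) q) + (C 0ω + h * eval (pmul p q))
      ≈⟨ +-cong (eval-scale a q) (trans (+-congʳ C-0) (trans (+-identityˡ _) (*-congˡ (eval-pmul p q)))) ⟩
    C a * eval q + h * (eval p * eval q)
      ≈⟨ solve 4 (λ a h p q → a :* q :+ h :* (p :* q) := (a :+ h :* p) :* q) refl (C a) h (eval p) (eval q) ⟩
    (C a + h * eval p) * eval q ∎

  eval-neg : ∀ p → eval (map -ᵣ_ p) ≈ - eval p
  eval-neg []      = sym -0#≈0#
  eval-neg (a ∷ p) = begin
    C (-ᵣ a) + h * eval (map -ᵣ_ p)  ≈⟨ +-cong (C-neg a) (*-congˡ (eval-neg p)) ⟩
    - C a + h * - eval p             ≈⟨ +-congˡ (-‿distribʳ-* h (eval p)) ⟨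
    - C a + - (h * eval p)           ≈⟨ -‿+-comm _ _ ⟩
    - (C a + h * eval p)             ∎

  eval-const : ∀ a → eval (a ∷ []) ≈ C a
  eval-const a = trans (+-congˡ (zeroʳ h)) (+-identityʳ _)

  eval-isRingHom : IsRingHom PolyOps R eval
  eval-isRingHom = record
    { 0-homo = refl
    ; 1-homo = trans (eval-const 1ω) C-1
    ; +-homo = eval-padd
    ; *-homo = eval-pmul
    ; neg-homo = eval-neg
    }

  eval-linear : ∀ a → eval (-ᵣ a ∷ 1ω ∷ []) ≈ h - C a
  eval-linear a = begin
    C (-ᵣ a) + h * eval (1ω ∷ [])  ≈⟨ +-cong (C-neg a) (*-congˡ (trans (eval-const 1ω) C-1)) ⟩
    - C a + h * 1#                 ≈⟨ +-congˡ (*-identityʳ h) ⟩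
    - C a + h                      ≈⟨ +-comm _ _ ⟩
    h - C a                        ∎

  module _ {p} (pr : Prime p) (char : ∀ x → p ×ᴿ x ≈ 0#)
    (C-fermat : ∀ l → C (ιℤ l) ^ p ≈ C (ιℤ l)) where

    -- Each factor h - l divides h ^ p - h separately. The roots may repeat, so their product is
    -- only claimed to divide the m-th power.
    prodLinear∣ : ∀ {m} (ls : Vec ℤ m) → ∃[ w ] (h ^ p - h) ^ m ≈ eval (prodLinear ls) * w
    prodLinear∣ Vec.[] = 1# , sym (trans (*-congʳ (trans (eval-const 1ω) C-1)) (*-identityˡ 1#))
    prodLinear∣ {suc m} (l Vec.∷ ls)
      with frobenius-fixed⇒∣ pr char h (C (ιℤ l)) (C-fermat l) | prodLinear∣ ls
    ... | w , e | w′ , e′ = w * w′ , (begin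
      (h ^ p - h) * (h ^ p - h) ^ m         ≈⟨ *-cong e e′ ⟩
      ((h - C (ιℤ l)) * w) * (q * w′)       ≈⟨ interchange _ w q w′ ⟩
      ((h - C (ιℤ l)) * q) * (w * w′)       ≈⟨ *-congʳ (*-congʳ (eval-linear (ιℤ l))) ⟨
      (eval linear * q) * (w * w′)          ≈⟨ *-congʳ (eval-pmul linear (prodLinear ls)) ⟨
      eval (pmul linear (prodLinear ls)) * (w * w′) ∎)
      where
      open import Algebra.Properties.CommutativeSemigroup *-commutativeSemigroup using (interchange)
      q = eval (prodLinear ls)
      linear = (-ᵣ ιℤ l) ∷ 1ω ∷ []

    integralRoots⇒nilpotent : ∀ {m} (ls : Vec ℤ m) → eval (prodLinear ls) ≈ 0# → (h ^ p - h) ^ m ≈ 0#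
    integralRoots⇒nilpotent ls z with prodLinear∣ ls
    ... | w , e = trans e (trans (*-congʳ z) (zeroˡ w))

-- Multipliers acting trivially on Γ

%3-* : ∀ j k {a b} → j % 3 ≡ a → k % 3 ≡ b → (j ℕ.* k) % 3 ≡ (a ℕ.* b) % 3
%3-* j k ≡.refl ≡.refl = %-distribˡ-* j k 3

module IdentityMultiplier (Γ : FinAbGroup) (Γ3 : FinAbGroup.Γ3Empty Γ) where
  open FinAbGroup Γ
  open GroupLaws Γ

  -- A nonzero element killed by 3 would have order exactly 3.
  3-torsion-free : ∀ g → 3 · g ≡ 𝟘 → g ≡ 𝟘
  3-torsion-free g 3g≡𝟘 with g Fin.≟ 𝟘
  ... | yes e = e
  ... | no g≢𝟘 = ⊥-elim (Γ3 g 3 (s≤s z≤n , 3g≡𝟘 , minimal) ∣-refl)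
    where
    minimal : ∀ j → 1 ≤ j → j < 3 → ¬ (j · g ≡ 𝟘)
    minimal zero () _
    minimal 1 _ _ e = g≢𝟘 (≡.trans (≡.sym (identityʳ g)) e)
    -- If 2 g = 0, then g = g + 2 g = 3 g = 0.
    minimal 2 _ _ e = g≢𝟘 (≡.trans (≡.sym (identityʳ g)) (≡.trans (cong (g ⊕_) (≡.sym e)) 3g≡𝟘))
    minimal (suc (suc (suc _))) _ (s≤s (s≤s (s≤s ())))

  -- Starting from the exponent n, cancel factors 3: if 3 q annihilates the group, then each q g is
  -- killed by 3 and hence zero. Positivity makes the exponent decrease strictly.
  prime-to-3-exponent : ∃[ e ] ¬ (3 ∣ e) × Annihilates e
  prime-to-3-exponent = <-rec _ strip n (ℕ.≤-trans (s≤s z≤n) (toℕ<n 𝟘)) n·g≡𝟘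
    where
    strip : ∀ e → (∀ {e′} → e′ < e → 0 < e′ → Annihilates e′ → ∃[ e ] ¬ (3 ∣ e) × Annihilates e) →
            0 < e → Annihilates e → ∃[ e ] ¬ (3 ∣ e) × Annihilates e
    strip e rec 0<e ann with 3 ∣? e
    ... | no 3∤e = e , 3∤e , ann
    ... | yes (divides (suc q) ≡.refl) = rec (ℕ.m<m*n (suc q) 3 (s≤s (s≤s z≤n))) (s≤s z≤n)
          λ g → 3-torsion-free _ (≡.trans (≡.sym (·-assoc 3 (suc q) g))
            (≡.trans (cong (_· g) (ℕ.*-comm 3 (suc q))) (ann g)))

  -- Any 1 + j e acts trivially. Take j = 1 if e is 1 modulo 3, and j = 2 if e is 2 modulo 3; in
  -- both cases j e is 1 modulo 3.
  identityMultiplier : ∃[ k ] k % 3 ≡ 2 × (∀ g → k · g ≡ g)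
  identityMultiplier with prime-to-3-exponent
  ... | e , 3∤e , ann with e % 3 in m | m%n<n e 3
  ...   | 0 | _ = ⊥-elim (3∤e (m%n≡0⇒n∣m e 3 m))
  ...   | 1 | _ = suc e , ≡.trans (%-distribˡ-+ 1 e 3) (cong (λ r → (1 ℕ.+ r) % 3) m)
                , λ g → ≡.trans (cong (g ⊕_) (ann g)) (identityʳ g)
  ...   | 2 | _ = suc (2 ℕ.* e) , ≡.trans (%-distribˡ-+ 1 (2 ℕ.* e) 3)
                    (cong (λ r → (1 ℕ.+ r) % 3) (%3-* 2 e ≡.refl m))
                , λ g → ≡.trans (cong (g ⊕_) (≡.trans (·-assoc 2 e g)
                    (≡.trans (cong (2 ·_) (ann g)) (≡.trans (identityˡ _) (identityˡ _))))) (identityʳ g)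
  ...   | suc (suc (suc _)) | s≤s (s≤s (s≤s ()))

-- Integral oriented Cayley graphs

ζ ζ̄ : ℤω
ζ = ⟨ + 1 , + 1 ⟩
ζ̄ = ⟨ + 0 , ℤ.- + 1 ⟩

arcValue : Bool → Bool → ℤω
arcValue true  true  = ⟨ + 1 , + 0 ⟩
arcValue true  false = ζ
arcValue false true  = ζ̄
arcValue false false = 0ω

-- The entry matrix in charPoly is local to its definition; unification recovers it here.
charMatrix : ∀ m H → Σ (Fin m → Fin m → List ℤω) λ E → charPoly m H ≡ DetDefs.det PolyOps m E
charMatrix m H = _ , ≡.refl

-- The equality test is an argument here, so that later proofs can split on it directly.
charEntry : ∀ {m} {r c : Fin m} → ℤω → Dec (r ≡ c) → List ℤω
charEntry x (yes _) = (-ᵣ x) ∷ 1ω ∷ []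
charEntry x (no  _) = (-ᵣ x) ∷ []

charMatrix≡charEntry : ∀ {m} H (r c : Fin m) →
                       proj₁ (charMatrix m H) r c ≡ charEntry (H r c) (r Fin.≟ c)
charMatrix≡charEntry H r c with r Fin.≟ c
... | yes _ = ≡.refl
... | no  _ = ≡.refl

-- The value 1 is missing because a skew-symmetric set admits no arcs in both directions.
data OrientedValue : ℤω → Set where
  isζ : OrientedValue ζ
  isζ̄ : OrientedValue ζ̄
  is0 : OrientedValue 0ω

conj-oriented : ∀ {x} → OrientedValue x → OrientedValue (conj x)
conj-oriented isζ = isζ̄
conj-oriented isζ̄ = isζ
conj-oriented is0 = is0

-- The difference of two distinct values has a coordinate 1 or -1, which no prime divides.
-- Congruences between weights therefore become equalities.
oriented-injective : ∀ {p} → Prime p → ∀ {x y} → OrientedValue x → OrientedValue y →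
                     Modulo._≈_ p x y → x ≡ y
oriented-injective {p} pr = go
  where
  open Modulo p using (_,_; _≈_)
  p∤1 : ¬ (p ∣ 1)
  p∤1 d = ¬prime[1] (≡.subst Prime (∣1⇒≡1 d) pr)
  go : ∀ {x y} → OrientedValue x → OrientedValue y → x ≈ y → x ≡ y
  go isζ isζ e = ≡.refl
  go isζ isζ̄ (r , i) = ⊥-elim (p∤1 (∣⇒∣ᵤ r))
  go isζ is0 (r , i) = ⊥-elim (p∤1 (∣⇒∣ᵤ r))
  go isζ̄ isζ (r , i) = ⊥-elim (p∤1 (∣⇒∣ᵤ r))
  go isζ̄ isζ̄ e = ≡.refl
  go isζ̄ is0 (r , i) = ⊥-elim (p∤1 (∣⇒∣ᵤ i))
  go is0 isζ (r , i) = ⊥-elim (p∤1 (∣⇒∣ᵤ r))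
  go is0 isζ̄ (r , i) = ⊥-elim (p∤1 (∣⇒∣ᵤ i))
  go is0 is0 e = ≡.refl

module CayleyGraph (Γ : FinAbGroup) (S : Subset (FinAbGroup.n Γ)) where
  open FinAbGroup Γ
  open GroupLaws Γ using (⁻¹-anti-homo‿-; ·-assoc; identityʳ; identityˡ; inverseˡ)

  -- As a function on the group this is also an element of the group ring, and the polynomials are
  -- evaluated there.
  weight : Fin n → ℤω
  weight g = arcValue (lookup S g) (lookup S (⊖ g))

  hermAdj2≡weight : ∀ u v → hermAdj2 Γ S u v ≡ weight (v ⊝ u)
  hermAdj2≡weight u v = ≡.trans unfold
    (cong (λ w → arcValue (lookup S (v ⊝ u)) (lookup S w)) (≡.sym (⁻¹-anti-homo‿- v u)))
    where
    unfold : hermAdj2 Γ S u v ≡ arcValue (lookup S (v ⊝ u)) (lookup S (u ⊝ v))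
    unfold with lookup S (v ⊝ u) | lookup S (u ⊝ v)
    ... | true  | true  = ≡.refl
    ... | true  | false = ≡.refl
    ... | false | true  = ≡.refl
    ... | false | false = ≡.refl

  -- The matrix as multiplication by `weight` in the group ring modulo p

  module AtPrime {p} (pr : Prime p) where
    open Modulo p using (ℤω/p; char-p; fermat)
    private module K = CommutativeRing ℤω/p
    open GroupRing ℤω/p Γ hiding (Carrier)
    open Determinant groupRing using (unitKernel⇒det≈0; det; module Homomorphism)
    open FiniteSums groupRing using (sum-single; sum-neg)
    open Characteristic groupRing
    open CommutativeRing groupRing hiding (zero)
    open import Algebra.Properties.Semiring.Sum semiring
    open import Algebra.Properties.Semiring.Mult semiring using () renaming (_×_ to _×ᴿ_)
    open import Algebra.Properties.Semiring.Exp semiring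
    open import Algebra.Properties.Semiring.Exp K.semiring using () renaming (_^_ to _^ᴷ_)
    open import Algebra.Properties.Semiring.Mult K.semiring using () renaming (_×_ to _×ᴷ_)
    open import Algebra.Properties.Ring ring
    open import Relation.Binary.Reasoning.Setoid setoid

    C : ℤω → Carrier
    C a = mono a 𝟘

    C-* : ∀ x y → C (x *ᵣ y) ≈ C x * C y
    C-* x y g = K.sym (K.trans (mono-✶ x y 𝟘 𝟘 g)
      (K.reflexive (cong (λ z → mono (x *ᵣ y) z g) (identityʳ 𝟘))))

    C-isRingHom : IsRingHom ℤωOps groupRing C
    C-isRingHom = record
      { 0-homo = mono-zero 𝟘
      ; 1-homo = refl
      ; +-homo = λ x y → mono-+ x y 𝟘
      ; *-homo = C-*
      ; neg-homo = λ x → mono-neg x 𝟘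
      }

    open Evaluation groupRing C C-isRingHom weight
    open Homomorphism PolyOps eval eval-isRingHom using (det-hom)

    entry : Fin n → Fin n → List ℤω
    entry = proj₁ (charMatrix n (hermAdj2 Γ S))

    δ : Fin n → Carrier
    δ g = mono 1ω g

    diagonal : ∀ {r c : Fin n} → Dec (r ≡ c) → Carrier
    diagonal (yes _) = weight
    diagonal (no  _) = 0#

    eval-charEntry : ∀ {r c} x (d : Dec (r ≡ c)) → eval (charEntry x d) ≈ diagonal d - C x
    eval-charEntry x (yes _) = eval-linear x
    eval-charEntry x (no  _) = trans (eval-const (-ᵣ x)) (trans (mono-neg x 𝟘) (sym (+-identityˡ (- C x))))

    eval-entry : ∀ r c → eval (entry r c) ≈ diagonal (r Fin.≟ c) - C (hermAdj2 Γ S r c)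
    eval-entry r c = trans (reflexive (cong eval (charMatrix≡charEntry (hermAdj2 Γ S) r c)))
      (eval-charEntry (hermAdj2 Γ S r c) (r Fin.≟ c))

    sum-diagonal : ∀ r → sum (λ c → δ c * diagonal (r Fin.≟ c)) ≈ δ r * weight
    sum-diagonal r = trans (sum-single r (λ c → δ c * diagonal (r Fin.≟ c)) (λ c → off c (r Fin.≟ c)))
      (on (r Fin.≟ r))
      where
      on : (d : Dec (r ≡ r)) → δ r * diagonal d ≈ δ r * weight
      on (yes _) = refl
      on (no ne) = ⊥-elim (ne ≡.refl)
      off : ∀ c (d : Dec (r ≡ c)) → c ≢ r → δ c * diagonal d ≈ 0#
      off c (yes e) c≢r = ⊥-elim (c≢r (≡.sym e))
      off c (no _)  c≢r = zeroʳ (δ c)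

    -- The row of r, read as a group ring element, is `weight` translated by r, and translation is
    -- multiplication by `δ r`.
    sum-row : ∀ r → sum (λ c → δ c * C (hermAdj2 Γ S r c)) ≈ δ r * weight
    sum-row r = begin
      sum (λ c → δ c * C (hermAdj2 Γ S r c))
        ≈⟨ sum-cong-≋ (λ c → trans (mono-✶ 1ω (hermAdj2 Γ S r c) c 𝟘) (λ x → K.trans
             (mono-cong (K.*-identityˡ _) (c ⊕ 𝟘) x)
             (K.reflexive (cong (λ g → mono (hermAdj2 Γ S r c) g x) (identityʳ c))))) ⟩
      sum (λ c → mono (hermAdj2 Γ S r c) c)
        ≈⟨ mono-expansion (hermAdj2 Γ S r) ⟨
      hermAdj2 Γ S r
        ≈⟨ (λ x → K.trans (K.reflexive (hermAdj2≡weight r x)) (K.sym (K.*-identityʳ _))) ⟩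
      (λ x → weight (x ⊝ r) *ᵣ 1ω)
        ≈⟨ ✶-mono weight 1ω r ⟨
      weight * δ r
        ≈⟨ *-comm weight (δ r) ⟩
      δ r * weight ∎

    kernel : ∀ r → sum (λ c → δ c * eval (entry r c)) ≈ 0#
    kernel r = begin
      sum (λ c → δ c * eval (entry r c))
        ≈⟨ sum-cong-≋ (λ c → trans (*-congˡ {δ c} (eval-entry r c)) (trans
             (distribˡ (δ c) (diagonal (r Fin.≟ c)) (- C (hermAdj2 Γ S r c)))
             (+-congˡ {δ c * diagonal (r Fin.≟ c)} (sym (-‿distribʳ-* (δ c) (C (hermAdj2 Γ S r c))))))) ⟩
      sum (λ c → δ c * diagonal (r Fin.≟ c) - δ c * C (hermAdj2 Γ S r c))
        ≈⟨ ∑-distrib-+ (λ c → δ c * diagonal (r Fin.≟ c)) (λ c → - (δ c * C (hermAdj2 Γ S r c))) ⟩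
      sum (λ c → δ c * diagonal (r Fin.≟ c)) + sum (λ c → - (δ c * C (hermAdj2 Γ S r c)))
        ≈⟨ +-cong (sum-diagonal r) (trans (sum-neg (λ c → δ c * C (hermAdj2 Γ S r c)))
             (-‿cong (sum-row r))) ⟩
      δ r * weight - δ r * weight
        ≈⟨ -‿inverseʳ (δ r * weight) ⟩
      0# ∎

    δ-inverse : ∀ g → δ (⊖ g) * δ g ≈ 1#
    δ-inverse g x = K.trans (mono-✶ 1ω 1ω (⊖ g) g x)
      (K.reflexive (cong (λ z → mono 1ω z x) (inverseˡ g)))

    -- Evaluation at `weight` turns the characteristic polynomial into the determinant of weight I -
    -- H over the group ring. The vector `δ` lies in the kernel of that matrix, and its entries are
    -- units, being group elements.
    cayleyHamilton : eval (charPoly n (hermAdj2 Γ S)) ≈ 0#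
    cayleyHamilton = begin
      eval (charPoly n (hermAdj2 Γ S))    ≡⟨ cong eval (proj₂ (charMatrix n (hermAdj2 Γ S))) ⟩
      eval (DetDefs.det PolyOps n entry)  ≈⟨ det-hom n entry ⟩
      det n (λ r c → eval (entry r c))    ≈⟨ unitKernel⇒det≈0 𝟘 (λ r c → eval (entry r c))
                                               (λ c → δ (⊖ c)) δ δ-inverse kernel ⟩
      0#                                  ∎

    char : ∀ f → p ×ᴿ f ≈ 0#
    char f x = K.trans (at p) (char-p (f x))
      where
      at : ∀ k → (k ×ᴿ f) x K.≈ k ×ᴷ f x
      at zero    = K.refl
      at (suc k) = K.+-congˡ {f x} (at k)

    C-frobenius : ∀ l → C (ιℤ l) ^ p ≈ C (ιℤ l)
    C-frobenius l x = K.trans (mono-^ (ιℤ l) 𝟘 p x) (K.trans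
      (mono-cong (fermat pr l) (p · 𝟘) x)
      (K.reflexive (cong (λ g → mono (ιℤ l) g x) (·𝟘 p))))
      where
      ·𝟘 : ∀ k → k · 𝟘 ≡ 𝟘
      ·𝟘 zero    = ≡.refl
      ·𝟘 (suc k) = ≡.trans (identityˡ _) (·𝟘 k)

    module _ (p·-injective : ∀ g g′ → p · g ≡ p · g′ → g ≡ g′) where

      -- Frobenius sends the monomial at g′ to one at p g′. Injectivity of multiplication by p
      -- prevents collisions, so only the monomial at g contributes at p g.
      frobenius-at : ∀ f g → (f ^ p) (p · g) K.≈ (f g ^ᴷ p)
      frobenius-at f g = K.trans (expand (p · g)) (K.trans
        (sumR-at (λ g′ → mono (f g′ ^ᴷ p) (p · g′)) (p · g)) (K.trans
        (FiniteSums.sum-single ℤω/p g (λ g′ → mono (f g′ ^ᴷ p) (p · g′) (p · g))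
          (λ g′ ne → mono-off (f g′ ^ᴷ p) (λ e → ne (≡.sym (p·-injective g g′ e)))))
        (mono-at (f g ^ᴷ p) {p · g} ≡.refl)))
        where
        expand : f ^ p ≈ sum (λ g′ → mono (f g′ ^ᴷ p) (p · g′))
        expand = begin
          f ^ p                                     ≈⟨ ^-congˡ p (mono-expansion f) ⟩
          sum (λ g′ → mono (f g′) g′) ^ p           ≈⟨ frobenius-sum pr char (λ g′ → mono (f g′) g′) ⟩
          sum (λ g′ → mono (f g′) g′ ^ p)           ≈⟨ sum-cong-≋ (λ g′ → mono-^ (f g′) g′ p) ⟩
          sum (λ g′ → mono (f g′ ^ᴷ p) (p · g′))    ∎

      -- Injectivity of Frobenius passes from the coefficients to the group ring, which is therefore
      -- reduced, and the nilpotent weight ^ p - weight is zero. The assumption on coefficients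
      -- fails for p = 3, where 1 - ω is nilpotent.
      weight-frobenius : (∀ x → x ^ᴷ p K.≈ 0ω → x K.≈ 0ω) → HSIntegral Γ S →
                         ∀ g → weight (p · g) K.≈ (weight g ^ᴷ p)
      weight-frobenius reducedK (ls , χ≈) g =
        K.trans (K.sym (weight^p≈weight (p · g))) (frobenius-at weight g)
        where
        prodLinear≈0 : eval (prodLinear ls) ≈ 0#
        prodLinear≈0 = trans (sym (eval-cong (charPoly n (hermAdj2 Γ S)) (prodLinear ls) χ≈)) cayleyHamilton

        frobenius-injective : ∀ f → f ^ p ≈ 0# → f ≈ 0#
        frobenius-injective f e x = reducedK (f x) (K.trans (K.sym (frobenius-at f x)) (e (p · x)))

        weight^p≈weight : weight ^ p ≈ weight
        weight^p≈weight = x∙y⁻¹≈ε⇒x≈y (weight ^ p) weight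
          (frobeniusInjective⇒reduced pr frobenius-injective n
            (integralRoots⇒nilpotent pr char C-frobenius ls prodLinear≈0))

  -- Multiplying group elements by k acts on the weights as the automorphism sending ω to ω ^ k,
  -- which depends only on k modulo 3.
  data Transforms (k : ℕ) : Set where
    fixes      : k % 3 ≡ 1 → (∀ g → weight (k · g) ≡ weight g) → Transforms k
    conjugates : k % 3 ≡ 2 → (∀ g → weight (k · g) ≡ conj (weight g)) → Transforms k

  transforms-* : ∀ {j k} → Transforms j → Transforms k → Transforms (j ℕ.* k)
  transforms-* {j} {k} (fixes m f) (fixes m′ f′) = fixes (%3-* j k m m′)
    λ g → ≡.trans (cong weight (·-assoc j k g)) (≡.trans (f (k · g)) (f′ g))
  transforms-* {j} {k} (fixes m f) (conjugates m′ f′) = conjugates (%3-* j k m m′)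
    λ g → ≡.trans (cong weight (·-assoc j k g)) (≡.trans (f (k · g)) (f′ g))
  transforms-* {j} {k} (conjugates m f) (fixes m′ f′) = conjugates (%3-* j k m m′)
    λ g → ≡.trans (cong weight (·-assoc j k g)) (≡.trans (f (k · g)) (cong conj (f′ g)))
  transforms-* {j} {k} (conjugates m f) (conjugates m′ f′) = fixes (%3-* j k m m′)
    λ g → ≡.trans (cong weight (·-assoc j k g)) (≡.trans (f (k · g))
      (≡.trans (cong conj (f′ g)) (conj-involutive (weight g))))

  module _ (skew : SkewSymmetric S) where

    weight-oriented : ∀ g → OrientedValue (weight g)
    weight-oriented g with lookup S g in e | lookup S (⊖ g) in e′
    ... | true  | true  = ⊥-elim (skew g (lookup⇒[]= g S e) (lookup⇒[]= (⊖ g) S e′))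
    ... | true  | false = isζ
    ... | false | true  = isζ̄
    ... | false | false = is0

    self-conjugate⇒∉ : ∀ g → weight g ≡ conj (weight g) → g ∉ S
    self-conjugate⇒∉ g e g∈S with lookup S g | []=⇒lookup g∈S | lookup S (⊖ g) in e′
    ... | true | ≡.refl | true  = skew g g∈S (lookup⇒[]= (⊖ g) S e′)
    -- The weight is `ζ` here, which differs from its conjugate.
    self-conjugate⇒∉ g () g∈S | true | ≡.refl | false

    -- Modulo p, Frobenius on the coefficients is the identity or conjugation according to p modulo
    -- 3. Either map has trivial kernel and preserves the three possible weights, so the congruence
    -- lifts to an equality.
    transforms-prime : HSIntegral Γ S → ∀ {p} → Prime p → ¬ (3 ∣ p) →
                       (∀ g g′ → p · g ≡ p · g′ → g ≡ g′) → Transforms p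
    transforms-prime int {p} pr 3∤p inj with p % 3 in m | m%n<n p 3
    ... | 0 | _ = ⊥-elim (3∤p (m%n≡0⇒n∣m p 3 m))
    ... | 1 | _ = fixes m λ g → oriented-injective pr
          (weight-oriented (p · g)) (weight-oriented g)
          (K.trans (weight-frobenius inj (λ x → K.trans (K.sym (σ x))) int g) (σ (weight g)))
      where
      module K = CommutativeRing (Modulo.ℤω/p p)
      open AtPrime pr
      σ = Modulo.frobenius-1mod3 p pr m
    ... | 2 | _ = conjugates m λ g → oriented-injective pr
          (weight-oriented (p · g)) (conj-oriented (weight-oriented g))
          (K.trans (weight-frobenius inj
            (λ x e → Modulo.conj≈0 p x (K.trans (K.sym (σ x)) e)) int g) (σ (weight g)))
      where
      module K = CommutativeRing (Modulo.ℤω/p p)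
      open AtPrime pr
      σ = Modulo.frobenius-2mod3 p pr m
    ... | suc (suc (suc _)) | s≤s (s≤s (s≤s ()))

    -- The condition that the partial product divides k is carried along so that every prime in the
    -- list divides k. Such a prime is not 3, and multiplication by it is injective.
    transforms-product : HSIntegral Γ S → ∀ k → ¬ (3 ∣ k) → (∀ g → k · g ≡ g) →
                         ∀ ps → All Prime ps → product ps ∣ k → Transforms (product ps)
    transforms-product int k 3∤k k·≡id [] [] d = fixes ≡.refl λ g → cong weight (identityʳ g)
    transforms-product int k 3∤k k·≡id (p ∷ ps) (pr ∷ prs) d = transforms-*
      (transforms-prime int pr (λ 3∣p → 3∤k (∣-trans 3∣p p∣k)) (p·-injective p∣k))
      (transforms-product int k 3∤k k·≡id ps prs (∣-trans (n∣m*n p) d))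
      where
      p∣k : p ∣ k
      p∣k = ∣-trans (m∣m*n (product ps)) d
      p·-injective : p ∣ k → ∀ g g′ → p · g ≡ p · g′ → g ≡ g′
      -- As k = q p acts as the identity, multiplication by q is a left inverse.
      p·-injective (divides q ≡.refl) g g′ e = begin
        g              ≡⟨ k·≡id g ⟨
        (q ℕ.* p) · g  ≡⟨ ·-assoc q p g ⟩
        q · (p · g)    ≡⟨ cong (q ·_) e ⟩
        q · (p · g′)   ≡⟨ ·-assoc q p g′ ⟨
        (q ℕ.* p) · g′ ≡⟨ k·≡id g′ ⟩
        g′             ∎
        where open ≡.≡-Reasoning

    -- The residue 2 leaves only conjugation, while k acts trivially on the group; hence every
    -- weight equals its own conjugate.
    transforms⇒empty : ∀ k → k % 3 ≡ 2 → (∀ g → k · g ≡ g) → Transforms k → Empty S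
    transforms⇒empty k k%3≡2 k·≡id (fixes k%3≡1 _) _ with () ← ≡.trans (≡.sym k%3≡2) k%3≡1
    transforms⇒empty k k%3≡2 k·≡id (conjugates _ f) (g , g∈S) =
      self-conjugate⇒∉ g (≡.trans (cong weight (≡.sym (k·≡id g))) (f g)) g∈S

    integral⇒empty : HSIntegral Γ S → ∀ k → k % 3 ≡ 2 → (∀ g → k · g ≡ g) → Empty S
    -- Zero must be set aside before factorising; its residue modulo 3 is not 2.
    integral⇒empty int zero () k·≡id
    integral⇒empty int k@(suc _) k%3≡2 k·≡id = transforms⇒empty k k%3≡2 k·≡id
      (≡.subst Transforms (≡.sym isFactorisation)
        (transforms-product int k 3∤k k·≡id factors factorsPrime
          (≡.subst (_∣ k) isFactorisation ∣-refl)))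
      where
      open PrimeFactorisation (factorise k)
      3∤k : ¬ (3 ∣ k)
      3∤k 3∣k with () ← ≡.trans (≡.sym k%3≡2) (n∣m⇒m%n≡0 k 3 3∣k)

-- The characteristic polynomial of the zero matrix

open DetDefs PolyOps using (det; sumFin; alt)

-- The zero polynomial need not be the empty list: the entries off the diagonal are `(-ᵣ 0ω) ∷ []`.
Vanishes : List ℤω → Set
Vanishes p = ∀ k → coeff p k ≡ 0ω

+ᵣ-identityˡ : ∀ x → 0ω +ᵣ x ≡ x
+ᵣ-identityˡ x = ≡.cong₂ ⟨_,_⟩ (ℤ.+-identityˡ _) (ℤ.+-identityˡ _)

+ᵣ-identityʳ : ∀ x → x +ᵣ 0ω ≡ x
+ᵣ-identityʳ x = ≡.cong₂ ⟨_,_⟩ (ℤ.+-identityʳ _) (ℤ.+-identityʳ _)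

*ᵣ-zeroʳ : ∀ x → x *ᵣ 0ω ≡ 0ω
*ᵣ-zeroʳ ⟨ a , b ⟩ = ≡.cong₂ ⟨_,_⟩ (eq₁ a b) (eq₂ a b)
  where
  eq₁ : ∀ a b → a ℤ.* + 0 ℤ.- b ℤ.* + 0 ≡ + 0
  eq₁ = solve-∀
  eq₂ : ∀ a b → a ℤ.* + 0 ℤ.+ b ℤ.* + 0 ℤ.- b ℤ.* + 0 ≡ + 0
  eq₂ = solve-∀

coeff-padd : ∀ p q k → coeff (padd p q) k ≡ coeff p k +ᵣ coeff q k
coeff-padd []      q       k       = ≡.sym (+ᵣ-identityˡ _)
coeff-padd (a ∷ p) []      k       = ≡.sym (+ᵣ-identityʳ _)
coeff-padd (a ∷ p) (b ∷ q) zero    = ≡.refl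
coeff-padd (a ∷ p) (b ∷ q) (suc k) = coeff-padd p q k

coeff-scale : ∀ a q k → coeff (map (a *ᵣ_) q) k ≡ a *ᵣ coeff q k
coeff-scale a []      k       = ≡.sym (*ᵣ-zeroʳ a)
coeff-scale a (b ∷ q) zero    = ≡.refl
coeff-scale a (b ∷ q) (suc k) = coeff-scale a q k

padd-vanishes : ∀ p q → Vanishes p → Vanishes q → Vanishes (padd p q)
padd-vanishes p q z z′ k = ≡.trans (coeff-padd p q k) (≡.cong₂ _+ᵣ_ (z k) (z′ k))

padd-cong : ∀ p p′ q q′ → p ≈ₚ p′ → q ≈ₚ q′ → padd p q ≈ₚ padd p′ q′
padd-cong p p′ q q′ e e′ k = ≡.trans (coeff-padd p q k)
  (≡.trans (≡.cong₂ _+ᵣ_ (e k) (e′ k)) (≡.sym (coeff-padd p′ q′ k)))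

pmul-congˡ : ∀ p {q q′} → q ≈ₚ q′ → pmul p q ≈ₚ pmul p q′
pmul-congˡ []      e k = ≡.refl
pmul-congˡ (a ∷ p) {q} {q′} e = padd-cong (map (a *ᵣ_) q) (map (a *ᵣ_) q′) _ _
  (λ k → ≡.trans (coeff-scale a q k) (≡.trans (cong (a *ᵣ_) (e k)) (≡.sym (coeff-scale a q′ k))))
  λ { zero → ≡.refl ; (suc k) → pmul-congˡ p e k }

-0∷[]-pmul-vanishes : ∀ q → Vanishes (pmul ((-ᵣ 0ω) ∷ []) q)
-0∷[]-pmul-vanishes q = padd-vanishes (map ((-ᵣ 0ω) *ᵣ_) q) (0ω ∷ [])
  (λ k → ≡.trans (coeff-scale (-ᵣ 0ω) q k) (0*ᵣ (coeff q k)))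
  λ { zero → ≡.refl ; (suc k) → ≡.refl }
  where
  0*ᵣ : ∀ x → 0ω *ᵣ x ≡ 0ω
  0*ᵣ ⟨ a , b ⟩ = ≡.cong₂ ⟨_,_⟩ (eq₁ a b) (eq₂ a b)
    where
    eq₁ : ∀ a b → + 0 ℤ.* a ℤ.- + 0 ℤ.* b ≡ + 0
    eq₁ = solve-∀
    eq₂ : ∀ a b → + 0 ℤ.* b ℤ.+ + 0 ℤ.* a ℤ.- + 0 ℤ.* b ≡ + 0
    eq₂ = solve-∀

alt-vanishes : ∀ j p → Vanishes p → Vanishes (alt j p)
alt-vanishes zero    p z = z
alt-vanishes (suc j) p z k = ≡.trans (coeff-neg (alt j p) k) (cong -ᵣ_ (alt-vanishes j p z k))
  where
  coeff-neg : ∀ p k → coeff (map -ᵣ_ p) k ≡ -ᵣ coeff p k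
  coeff-neg []      k       = ≡.refl
  coeff-neg (a ∷ p) zero    = ≡.refl
  coeff-neg (a ∷ p) (suc k) = coeff-neg p k

sumFin-vanishes : ∀ {m} (f : Fin m → List ℤω) → (∀ j → Vanishes (f j)) → Vanishes (sumFin f)
sumFin-vanishes {zero}  f z k = ≡.refl
sumFin-vanishes {suc m} f z = padd-vanishes (f zero) (sumFin (f ∘ suc)) (z zero)
  (sumFin-vanishes (f ∘ suc) (z ∘ suc))

-- In the expansion along the first row only the diagonal term survives, and its minor has the same
-- shape. Each step contributes one linear factor with root 0.
det-xI : ∀ {m} (E : Fin m → Fin m → List ℤω) →
         (∀ r → E r r ≡ (-ᵣ 0ω) ∷ 1ω ∷ []) → (∀ r c → r ≢ c → E r c ≡ (-ᵣ 0ω) ∷ []) →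
         det m E ≈ₚ prodLinear (replicate m (+ 0))
det-xI {zero}  E on off k = ≡.refl
det-xI {suc m} E on off k = begin
  coeff (padd head tail) k       ≡⟨ coeff-padd head tail k ⟩
  coeff head k +ᵣ coeff tail k   ≡⟨ cong (coeff head k +ᵣ_) (sumFin-vanishes _ offDiagonal k) ⟩
  coeff head k +ᵣ 0ω             ≡⟨ +ᵣ-identityʳ _ ⟩
  coeff head k                   ≡⟨ cong (λ e → coeff (pmul e minor) k) (on zero) ⟩
  coeff (pmul ((-ᵣ 0ω) ∷ 1ω ∷ []) minor) k
    ≡⟨ pmul-congˡ ((-ᵣ 0ω) ∷ 1ω ∷ []) {minor} {prodLinear (replicate m (+ 0))}
         (det-xI (λ r c → E (suc r) (suc c)) (λ r → on (suc r))
           (λ r c ne → off (suc r) (suc c) λ { ≡.refl → ne ≡.refl })) k ⟩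
  coeff (prodLinear (replicate (suc m) (+ 0))) k ∎
  where
  open ≡.≡-Reasoning
  minor = det m (λ r c → E (suc r) (suc c))
  head = pmul (E zero zero) minor
  term : Fin m → List ℤω
  term j = alt (toℕ (suc j)) (pmul (E zero (suc j)) (det m (λ r c → E (suc r) (punchIn (suc j) c))))
  tail = sumFin term
  offDiagonal : ∀ j → Vanishes (term j)
  offDiagonal j = alt-vanishes (toℕ (suc j)) _ (≡.subst (λ e → Vanishes (pmul e D)) (≡.sym (off zero (suc j) λ ()))
    (-0∷[]-pmul-vanishes D))
    where
    D = det m (λ r c → E (suc r) (punchIn (suc j) c))

charPoly-zero : ∀ m H → (∀ r c → H r c ≡ 0ω) → charPoly m H ≈ₚ prodLinear (replicate m (+ 0))
charPoly-zero m H H≡0 k = ≡.trans (cong (λ q → coeff q k) (proj₂ (charMatrix m H)))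
  (det-xI E (λ r → ≡.trans (charMatrix≡charEntry H r r) (on r (r Fin.≟ r)))
            (λ r c ne → ≡.trans (charMatrix≡charEntry H r c) (off r c ne (r Fin.≟ c))) k)
  where
  E = proj₁ (charMatrix m H)
  on : ∀ r (d : Dec (r ≡ r)) → charEntry (H r r) d ≡ (-ᵣ 0ω) ∷ 1ω ∷ []
  on r (yes _) = cong (λ x → (-ᵣ x) ∷ 1ω ∷ []) (H≡0 r r)
  on r (no ne) with () ← ne ≡.refl
  off : ∀ r c → r ≢ c → (d : Dec (r ≡ c)) → charEntry (H r c) d ≡ (-ᵣ 0ω) ∷ []
  off r c ne (yes e) with () ← ne e
  off r c ne (no _) = cong (λ x → (-ᵣ x) ∷ []) (H≡0 r c)

empty⇒integral : (Γ : FinAbGroup) (S : Subset (FinAbGroup.n Γ)) → Empty S → HSIntegral Γ S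
empty⇒integral Γ S empty = replicate n (+ 0) , charPoly-zero n (hermAdj2 Γ S)
  λ u v → ≡.trans (hermAdj2≡weight u v)
    (≡.cong₂ arcValue (lookup≡false (v ⊝ u)) (lookup≡false (⊖ (v ⊝ u))))
  where
  open FinAbGroup Γ
  open CayleyGraph Γ S using (hermAdj2≡weight)
  lookup≡false : ∀ g → lookup S g ≡ false
  lookup≡false g with lookup S g in e
  ... | true  = ⊥-elim (empty (g , lookup⇒[]= g S e))
  ... | false = ≡.refl

theorem3p2 : (Γ : FinAbGroup) → FinAbGroup.Γ3Empty Γ →
    (S : Subset (FinAbGroup.n Γ)) → FinAbGroup.SkewSymmetric Γ S →
    FinAbGroup.𝟘 Γ ∉ S →
    (HSIntegral Γ S ⇔ Empty S)
theorem3p2 Γ Γ3 S skew 𝟘∉S = mk⇔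
  (λ integral → integral⇒empty skew integral k k%3≡2 k·≡id)
  (empty⇒integral Γ S)
  where
  open CayleyGraph Γ S using (integral⇒empty)
  open IdentityMultiplier Γ Γ3 using (identityMultiplier)
  k = proj₁ identityMultiplier
  k%3≡2 = proj₁ (proj₂ identityMultiplier)
  k·≡id = proj₂ (proj₂ identityMultiplier)
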